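{- Let $G$ be a finite abelian group. Then \[k_{\mathsf{D}}(G)\le \delta(G)\exp(G)|\mathcal{A}(G)|+ \eta(G)-\mathsf{D}(G^-).\] In particular, $k_{\mathsf{D}}(G)\le (2|G|)^{4|G|+2}$.
   Context: $G$ is written additively. A sequence over $G$ is a finite unordered list of elements with repetitions (element of the free abelian monoid $\mathcal{F}(G)$); zero-sum means the terms sum to $0$; a minimal zero-sum sequence is a non-empty zero-sum sequence with no proper non-empty zero-sum subsequence, and $\mathcal{A}(G)$ is the set of these. $\mathsf{D}_k(G)$ ($k\in\mathbb{N}$) is the smallest $\ell$ such that every sequence of length at least $\ell$ has $k$ disjoint non-empty zero-sum subsequences; $\mathsf{D}(G)=\mathsf{D}_1(G)$. It is known that there is $\mathsf{D}_0(G)\in\mathbb{N}_0$ with $\mathsf{D}_k(G)=\mathsf{D}_0(G)+k\exp(G)$ for all sufficiently large $k$; $k_{\mathsf{D}}(G)$ is the minimal $k_0\in\mathbb{N}$ such that $\mathsf{D}_k(G)=\mathsf{D}_0(G)+k\exp(G)$ for all $k\ge k_0$. $\eta(G)$ is the smallest $\ell$ such that every sequence of length at least $\ell$ has a non-empty zero-sum subsequence of length at most $\exp(G)$. $G^-$ is an abelian group with $G\cong G^-\oplus C_{\exp(G)}$. Factorizations: elements of the free abelian monoid $\mathsf{Z}(G)$ over $\mathcal{A}(G)$, $\pi$ evaluates the product, $|\zeta|$ is the number of factors, $\mathsf{L}(B)$ the set of factorization lengths of $B$; $\mathsf{d}(\zeta,\xi)=\max\{|\gcd(\zeta,\xi)^{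 -1}\zeta|,|\gcd(\zeta,\xi)^{ -1}\xi|\}$; distinct $k,\ell\in\mathsf{L}(B)$ are adjacent if no element of $\mathsf{L}(B)$ lies strictly between them; $\delta(\zeta)$ is the least $m\in\mathbb{N}_0$ such that for each $k\in\mathbb{N}$ adjacent to $|\zeta|$ in $\mathsf{L}(\pi(\zeta))$ there is a factorization $\xi$ of $\pi(\zeta)$ with $|\xi|=k$ and $\mathsf{d}(\xi,\zeta)\le m$; $\delta(G)=\sup_\zeta \delta(\zeta)$.
   Formalization: The first inequality is stated for |G| > 1 only: for the trivial group it is false, since there k_D(G) = 1 while δ(G) = 0 and η(G) = D(G⁻) = 1 give the right-hand side 0; the second bound is stated for every finite abelian group. -}

module Defs where

open import Level using (Level; _⊔_; 0ℓ)
open import Algebra.Bundles using (AbelianGroup)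
open import Algebra.Construct.DirectProduct using () renaming (abelianGroup to _⊕_)
open import Algebra.Definitions.RawMonoid using () renaming (_×_ to multiple)
open import Algebra.Morphism.Structures using (module GroupMorphisms)
open import Data.Fin.Base using (Fin)
open import Data.Integer.Base using (ℤ; +_; 0ℤ)
import Data.Integer.Base as ℤ
import Data.Integer.Properties as ℤ
import Data.Integer.Divisibility.Signed as ℤ
open import Data.Integer.Tactic.RingSolver using (solve-∀)
open import Data.List.Base using (List; []; _++_; map; concat; foldr; length)
open import Data.List.Relation.Unary.All using (All)
import Data.List.Relation.Binary.Permutation.Setoid as Permutation
open import Data.Nat.Base as ℕ using (ℕ; _≤_; _<_)
open import Data.Product.Base using (Σ; ∃-syntax; _×_; _,_; proj₁)
open import Data.Sum.Base using (_⊎_)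
open import Function.Bundles using (Inverse)
open import Relation.Binary.Bundles using (Setoid)
import Relation.Binary.Construct.On as On
open import Relation.Binary.PropositionalEquality using (_≡_; _≢_; subst; sym; setoid)
open import Relation.Nullary.Negation using (¬_)

private variable
  a b c ℓ : Level

IsLeast : (ℕ → Set a) → ℕ → Set a
IsLeast P n = P n × (∀ m → P m → n ≤ m)

HasCardinality : Setoid a b → ℕ → Set (a ⊔ b)
HasCardinality S n = Inverse S (setoid (Fin n))

-- The free abelian monoid over a setoid: lists up to permutation, with
-- concatenation as multiplication and length as |·|.
module FreeAbelianMonoid (S : Setoid a b) where
  open Setoid S using (Carrier)
  open Permutation S using (_↭_) public

  infix 4 _∣_

  _∣_ : List Carrier → List Carrier → Set (a ⊔ b)
  x ∣ y = ∃[ z ] x ++ z ↭ y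

  IsGCD : List Carrier → List Carrier → List Carrier → Set (a ⊔ b)
  IsGCD g x y = g ∣ x × g ∣ y × (∀ h → h ∣ x → h ∣ y → h ∣ g)

  -- IsDistance x y m : m = max { |gcd(x,y)⁻¹x| , |gcd(x,y)⁻¹y| }
  IsDistance : List Carrier → List Carrier → ℕ → Set (a ⊔ b)
  IsDistance x y m = ∃[ g ] ∃[ x′ ] ∃[ y′ ]
    IsGCD g x y × g ++ x′ ↭ x × g ++ y′ ↭ y × m ≡ length x′ ℕ.⊔ length y′

-- C_n, realised as ℤ with equality taken modulo n.
module _ (n : ℕ) where

  private
    _≈_ : ℤ → ℤ → Set
    x ≈ y = + n ℤ.∣ (x ℤ.- y)

    reflexive : ∀ {x y} → x ≡ y → x ≈ y
    reflexive {x} {y} eq =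
      subst (+ n ℤ.∣_) (sym (ℤ.i≡j⇒i-j≡0 eq)) (ℤ.divides 0ℤ (sym (ℤ.*-zeroˡ (+ n))))

    ≈-sym : ∀ {x y} → x ≈ y → y ≈ x
    ≈-sym {x} {y} p = subst (+ n ℤ.∣_) (eq x y) (ℤ.∣m⇒∣-m p)
      where
      eq : ∀ x y → ℤ.- (x ℤ.- y) ≡ y ℤ.- x
      eq = solve-∀

    ≈-trans : ∀ {x y z} → x ≈ y → y ≈ z → x ≈ z
    ≈-trans {x} {y} {z} p q = subst (+ n ℤ.∣_) (eq x y z) (ℤ.∣m∣n⇒∣m+n p q)
      where
      eq : ∀ x y z → (x ℤ.- y) ℤ.+ (y ℤ.- z) ≡ x ℤ.- z
      eq = solve-∀

    +-cong : ∀ {x y u v} → x ≈ y → u ≈ v → (x ℤ.+ u) ≈ (y ℤ.+ v)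
    +-cong {x} {y} {u} {v} p q = subst (+ n ℤ.∣_) (eq x y u v) (ℤ.∣m∣n⇒∣m+n p q)
      where
      eq : ∀ x y u v → (x ℤ.- y) ℤ.+ (u ℤ.- v) ≡ (x ℤ.+ u) ℤ.- (y ℤ.+ v)
      eq = solve-∀

    neg-cong : ∀ {x y} → x ≈ y → (ℤ.- x) ≈ (ℤ.- y)
    neg-cong {x} {y} p = subst (+ n ℤ.∣_) (eq x y) (ℤ.∣m⇒∣-m p)
      where
      eq : ∀ x y → ℤ.- (x ℤ.- y) ≡ (ℤ.- x) ℤ.- (ℤ.- y)
      eq = solve-∀

  Cyclic : AbelianGroup 0ℓ 0ℓ
  Cyclic = record
    { Carrier = ℤ
    ; _≈_     = _≈_
    ; _∙_     = ℤ._+_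
    ; ε       = 0ℤ
    ; _⁻¹     = ℤ.-_
    ; isAbelianGroup = record
      { isGroup = record
        { isMonoid = record
          { isSemigroup = record
            { isMagma = record
              { isEquivalence = record
                { refl  = λ {x} → reflexive {x} {x} _≡_.refl
                ; sym   = λ {x} {y} → ≈-sym {x} {y}
                ; trans = λ {x} {y} {z} → ≈-trans {x} {y} {z}
                }
              ; ∙-cong = λ {x} {y} {u} {v} → +-cong {x} {y} {u} {v}
              }
            ; assoc = λ x y z → reflexive (ℤ.+-assoc x y z)
            }
          ; identity = (λ x → reflexive (ℤ.+-identityˡ x)) , (λ x → reflexive (ℤ.+-identityʳ x))
          }
        ; inverse = (λ x → reflexive (ℤ.+-inverseˡ x)) , (λ x → reflexive (ℤ.+-inverseʳ x))
        ; ⁻¹-cong = λ {x} {y} → neg-cong {x} {y}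
        }
      ; comm = λ x y → reflexive (ℤ.+-comm x y)
      }
    }

_≅_ : ∀ {c₁ ℓ₁ c₂ ℓ₂} → AbelianGroup c₁ ℓ₁ → AbelianGroup c₂ ℓ₂ → Set (c₁ ⊔ ℓ₁ ⊔ c₂ ⊔ ℓ₂)
G ≅ H = ∃[ f ] GroupMorphisms.IsGroupIsomorphism (AbelianGroup.rawGroup G) (AbelianGroup.rawGroup H) f

module _ (G : AbelianGroup c ℓ) where
  private module G = AbelianGroup G
  open G using (Carrier; _≈_; _∙_; ε)
  open FreeAbelianMonoid G.setoid using (_↭_; _∣_)

  HasOrder : ℕ → Set (c ⊔ ℓ)
  HasOrder = HasCardinality G.setoid

  IsExponent : ℕ → Set (c ⊔ ℓ)
  IsExponent = IsLeast λ n → 1 ≤ n × (∀ x → multiple G.rawMonoid n x ≈ ε)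

  ZeroSum : List Carrier → Set ℓ
  ZeroSum S = foldr _∙_ ε S ≈ ε

  NonEmptyZeroSum : List Carrier → Set (c ⊔ ℓ)
  NonEmptyZeroSum S = S ≢ [] × ZeroSum S

  MinimalZeroSum : List Carrier → Set (c ⊔ ℓ)
  MinimalZeroSum S =
    NonEmptyZeroSum S × ¬ (∃[ T ] T ∣ S × ¬ (T ↭ S) × NonEmptyZeroSum T)

  DisjointZeroSums : ℕ → List Carrier → Set (c ⊔ ℓ)
  DisjointZeroSums k S =
    ∃[ Ts ] length Ts ≡ k × All NonEmptyZeroSum Ts × concat Ts ∣ S

  -- IsD k d : d = D_k(G).  Only meant for k ≥ 1; the constant D_0(G) is IsD₀.
  IsD : ℕ → ℕ → Set (c ⊔ ℓ)
  IsD k = IsLeast λ l → ∀ S → l ≤ length S → DisjointZeroSums k S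

  -- Throughout, e stands for exp(G) and d₀ for D_0(G); k₀ ranges over positive integers.
  DFormulaFrom : (e d₀ k₀ : ℕ) → Set (c ⊔ ℓ)
  DFormulaFrom e d₀ k₀ = 1 ≤ k₀ × (∀ k → k₀ ≤ k → IsD k (d₀ ℕ.+ k ℕ.* e))

  IsD₀ : (e d₀ : ℕ) → Set (c ⊔ ℓ)
  IsD₀ e d₀ = ∃[ k₀ ] DFormulaFrom e d₀ k₀

  IsEta : (e l : ℕ) → Set (c ⊔ ℓ)
  IsEta e = IsLeast λ l → ∀ S → l ≤ length S →
    ∃[ T ] T ∣ S × NonEmptyZeroSum T × length T ≤ e

  -- IskD e d₀ k : k = k_D(G).
  IskD : (e d₀ k : ℕ) → Set (c ⊔ ℓ)
  IskD e d₀ = IsLeast (DFormulaFrom e d₀)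

  Atom : Set (c ⊔ ℓ)
  Atom = Σ (List Carrier) MinimalZeroSum

  𝒜 : Setoid (c ⊔ ℓ) (c ⊔ ℓ)
  𝒜 = On.setoid {B = Atom} (Permutation.↭-setoid G.setoid) proj₁

  Factorization : Set (c ⊔ ℓ)
  Factorization = List Atom

  open FreeAbelianMonoid 𝒜 using (IsDistance)

  π : Factorization → List Carrier
  π ζ = concat (map proj₁ ζ)

  _IsFactorizationOf_ : Factorization → List Carrier → Set (c ⊔ ℓ)
  ζ IsFactorizationOf B = π ζ ↭ B

  _∈L_ : ℕ → List Carrier → Set (c ⊔ ℓ)
  k ∈L B = ∃[ ζ ] ζ IsFactorizationOf B × length ζ ≡ k

  Adjacent : List Carrier → ℕ → ℕ → Set (c ⊔ ℓ)
  Adjacent B k l = k ∈L B × l ∈L B × k ≢ l ×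
    ¬ (∃[ m ] m ∈L B × (k < m × m < l ⊎ l < m × m < k))

  IsLocalDelta : Factorization → ℕ → Set (c ⊔ ℓ)
  IsLocalDelta ζ = IsLeast λ m → ∀ k → 1 ≤ k → Adjacent (π ζ) (length ζ) k →
    ∃[ ξ ] ξ IsFactorizationOf π ζ × length ξ ≡ k × ∃[ d ] IsDistance ξ ζ d × d ≤ m

  -- δ(G) as a natural number; when the supremum is infinite no n satisfies this.
  IsDelta : ℕ → Set (c ⊔ ℓ)
  IsDelta = IsLeast λ n → ∀ ζ m → IsLocalDelta ζ m → m ≤ n

  -- IsMinusPart e H : H is a G⁻.
  IsMinusPart : ∀ {c′ ℓ′} → ℕ → AbelianGroup c′ ℓ′ → Set (c ⊔ ℓ ⊔ c′ ⊔ ℓ′)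
  IsMinusPart e H = G ≅ (H ⊕ Cyclic e)

{-# OPTIONS --safe #-}

-- Call a partition of a zero-sum sequence B into zero-sum blocks optimal if
-- no partition of B has more blocks.  If a sequence S of length d₀ + k e has
-- no k disjoint blocks, then B = S (−σ(S)) has an optimal partition with at
-- most k blocks, and B is so long that, by the definition of η, all but a few
-- of these blocks have length at least e.  If one of them, U, can be added
-- to B without raising the optimal number of blocks by more than one, then
-- U B contradicts the formula for D_{k+1}.  Hence the formula descends from
-- k + 1 to k as soon as there are enough long blocks to find such a U.
--
-- First bound: a block U occurring at least δ times will do.  Otherwise a
-- factorization of U B of the next larger length lies at distance at most δ
-- from the given one, hence still contains U, and removing U improves B.
--
-- Second bound: an exchange argument (two sets of blocks with equal sum)
-- reduces every optimal partition to at most s = 4 n² different blocks.  If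
-- U is one of them with multiplicity at least (2 s n + 1)^n and x′ is a
-- better partition of U B than the one x obtained from B, then rounding
-- (j / i) x and (j / i) x′ down for 0 ≤ j < i (i the multiplicity of U in x)
-- and the pigeonhole principle split (x, x′) into two pairs with equal sums,
-- neither of which uses U more often than the partition of B does; one of
-- them improves the partition of B.
module Submission where

open import Defs
open import Algebra.Bundles using (AbelianGroup)
open import Algebra.Construct.DirectProduct using () renaming (abelianGroup to _⊕_)
open import Algebra.Definitions.RawMonoid using () renaming (_×_ to multiple)
open import Algebra.Morphism.Structures using (module GroupMorphisms)
import Algebra.Properties.CommutativeMonoid.Sum as CommutativeMonoidSum
import Algebra.Properties.Group as GroupProperties
open import Data.Bool.Base using (true; false; if_then_else_)
open import Data.Fin.Base using (Fin; zero; suc; toℕ; fromℕ<; finToFun; funToFin; combine)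
import Data.Fin.Base as Fin
import Data.Fin.Permutation as Fin
import Data.Fin.Properties as Fin
open import Data.Integer.Base using (ℤ; 0ℤ; 1ℤ)
import Data.Integer.Base as ℤ
import Data.Integer.Divisibility.Signed as ℤ
import Data.Integer.Properties as ℤ
open import Data.List.Base using (List; []; _∷_; _++_; map; concat; length; replicate; tabulate; filter; foldr; take; drop)
import Data.List.Properties as List
import Data.List.Relation.Binary.Permutation.Setoid as Permutation
import Data.List.Relation.Binary.Permutation.Setoid.Properties as PermutationProperties
open import Data.List.Relation.Binary.Pointwise.Base using (Pointwise; []; _∷_)
open import Data.List.Relation.Unary.All as All using (All; []; _∷_)
import Data.List.Relation.Unary.All.Properties as All
open import Data.Nat.Base
open import Data.Nat.DivMod using (m/n*n≤m; m≡m%n+[m/n]*n; m%n<n; m*n/n≡m; /-monoˡ-≤)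
open import Data.Nat.Divisibility using (∣⇒≤) renaming (_∣_ to _divides_)
import Data.Nat.ListAction as List
open import Data.Nat.Properties
open import Data.Nat.Tactic.RingSolver using (solve-∀)
open import Data.Product.Base using (Σ-syntax; ∃-syntax; _×_; _,_; proj₁; proj₂)
open import Data.Sum.Base using (_⊎_; inj₁; inj₂)
open import Data.Vec.Functional using (updateAt)
open import Data.Vec.Functional.Properties using (updateAt-updates; updateAt-minimal)
open import Function.Base using (_∘_; const)
open import Function.Bundles using (Inverse)
import Level as L
open import Relation.Binary.Bundles using (Setoid)
open import Relation.Binary.PropositionalEquality using (_≡_; _≢_; refl; sym; trans; cong; cong₂; subst; module ≡-Reasoning)
import Relation.Binary.Reasoning.Setoid as SetoidReasoning
open import Relation.Nullary.Decidable using (Dec; does; yes; no; dec-true; dec-false; map′; _×-dec_)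
open import Relation.Nullary.Negation using (¬_; contradiction)
open import Relation.Unary using (Decidable)
open import Algebra.Properties.CommutativeMonoid.Sum +-0-commutativeMonoid using (sum; sum-cong-≗; ∑-distrib-+; sum-replicate-zero)
open import Algebra.Properties.Semiring.Sum +-*-semiring using (*-distribˡ-sum)

private variable
  a b r : L.Level

-- Extrema up to double negation, and finite sums.

¬¬-least : (P : ℕ → Set r) → ∀ k → P k → ¬ ¬ (∃[ m ] IsLeast P m)
¬¬-least P k Pk ¬least = none k k ≤-refl Pk
  where
  none : ∀ b k → k ≤ b → ¬ P k
  none zero    k k≤b Pk = ¬least (k , Pk , λ m _ → ≤-trans k≤b z≤n)
  none (suc b) k k≤b Pk = ¬least (k , Pk , λ m Pm → ≮⇒≥ λ m<k →
    none b m (s≤s⁻¹ (≤-trans m<k k≤b)) Pm)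

-- Without deciding `P`, an extremum exists only up to double negation. This suffices wherever the
-- goal is a negation, or an inequality reached through `≮⇒≥`. The number `c` bounds how far `k` can
-- still grow.
¬¬-greatest : (P : ℕ → Set r) → ∀ b → (∀ k → P k → k ≤ b) →
  ∀ k → P k → ¬ ¬ (∃[ m ] P m × (∀ j → P j → j ≤ m))
¬¬-greatest P b bounded k Pk ¬greatest = none b k (m≤n+m b k) Pk
  where
  none : ∀ c k → b ≤ k + c → ¬ P k
  none zero    k b≤ Pk = ¬greatest (k , Pk , λ j Pj →
    ≤-trans (bounded j Pj) (subst (b ≤_) (+-identityʳ k) b≤))
  none (suc c) k b≤ Pk = ¬greatest (k , Pk , λ j Pj → ≮⇒≥ λ k<j →
    none c j (≤-trans b≤ (≤-trans (≤-reflexive (+-suc k c)) (+-monoˡ-≤ c k<j))) Pj)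

sum-mono-≤ : ∀ {N} {f g : Fin N → ℕ} → (∀ i → f i ≤ g i) → sum f ≤ sum g
sum-mono-≤ {zero}  f≤g = z≤n
sum-mono-≤ {suc N} f≤g = +-mono-≤ (f≤g zero) (sum-mono-≤ (f≤g ∘ suc))

sum-bound : ∀ {N} {f : Fin N → ℕ} {b} → (∀ i → f i ≤ b) → sum f ≤ N * b
sum-bound {zero}  f≤b = z≤n
sum-bound {suc N} f≤b = +-mono-≤ (f≤b zero) (sum-bound (f≤b ∘ suc))

-- If all values were below `b`, the sum would be below `N * b`. The condition `1 ≤ N * b` excludes
-- in particular the empty index set, where no index can be returned.
sum-pigeonhole : ∀ {N} (f : Fin N → ℕ) b → 1 ≤ N * b → N * b ≤ sum f → ∃[ i ] b ≤ f i
sum-pigeonhole {N} f b 1≤Nb Nb≤ with Fin.any? (λ i → b ≤? f i)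
... | yes found = found
... | no  none  = contradiction Nb≤ (<⇒≱ (below N f b 1≤Nb λ i → ≰⇒> (none ∘ (i ,_))))
  where
  below : ∀ N (f : Fin N → ℕ) b → 1 ≤ N * b → (∀ i → f i < b) → sum f < N * b
  below (suc N) f (suc b) _ f<b = s≤s (+-mono-≤ (s≤s⁻¹ (f<b zero))
    (sum-bound {N} (λ i → <⇒≤ (f<b (suc i)))))
  below (suc N) f zero    _ f<b = contradiction (f<b zero) λ ()

sum-∸ : ∀ {N} (f g : Fin N → ℕ) → (∀ i → g i ≤ f i) → sum (λ i → f i ∸ g i) + sum g ≡ sum f
sum-∸ f g g≤f = trans (sym (∑-distrib-+ (λ i → f i ∸ g i) g)) (sum-cong-≗ λ i → m∸n+n≡m (g≤f i))

-- Multisets as lists, compared by counting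

indicator : ∀ {N} → Fin N → Fin N → ℕ
indicator i j = if does (i Fin.≟ j) then 1 else 0

indicator-≡ : ∀ {N} {i j : Fin N} → i ≡ j → indicator i j ≡ 1
indicator-≡ {i = i} {j} eq rewrite dec-true (i Fin.≟ j) eq = refl

indicator-≢ : ∀ {N} {i j : Fin N} → i ≢ j → indicator i j ≡ 0
indicator-≢ {i = i} {j} neq rewrite dec-false (i Fin.≟ j) neq = refl

indicator-suc : ∀ {N} (i j : Fin N) → indicator (suc i) (suc j) ≡ indicator i j
indicator-suc i j with i Fin.≟ j
... | yes refl = refl
... | no  i≢j  = refl

indicator≤1 : ∀ {N} (i j : Fin N) → indicator i j ≤ 1
indicator≤1 i j with i Fin.≟ j
... | yes _ = ≤-refl
... | no  _ = z≤n

sum-indicatorˡ : ∀ {N} (f : Fin N → ℕ) j → sum (λ i → f i * indicator i j) ≡ f j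
sum-indicatorˡ {suc N} f zero = begin
  f zero * 1 + sum (λ i → f (suc i) * 0) ≡⟨ cong₂ _+_ (*-identityʳ (f zero)) (sum-cong-≗ λ i → *-zeroʳ (f (suc i))) ⟩
  f zero + sum {N} (λ _ → 0)             ≡⟨ cong (f zero +_) (sum-replicate-zero N) ⟩
  f zero + 0                             ≡⟨ +-identityʳ (f zero) ⟩
  f zero                                 ∎
  where open ≡-Reasoning
sum-indicatorˡ {suc N} f (suc j) = begin
  f zero * 0 + sum (λ i → f (suc i) * indicator (suc i) (suc j))
    ≡⟨ cong₂ _+_ (*-zeroʳ (f zero)) (sum-cong-≗ λ i → cong (f (suc i) *_) (indicator-suc i j)) ⟩
  sum (λ i → f (suc i) * indicator i j)
    ≡⟨ sum-indicatorˡ (f ∘ suc) j ⟩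
  f (suc j) ∎
  where open ≡-Reasoning

indicator-sym : ∀ {N} (i j : Fin N) → indicator i j ≡ indicator j i
indicator-sym i j with i Fin.≟ j
... | yes refl = sym (indicator-≡ {i = i} refl)
... | no  i≢j  = sym (indicator-≢ (i≢j ∘ sym))

sum-indicator : ∀ {N} (i : Fin N) → sum (indicator i) ≡ 1
sum-indicator i = trans
  (sum-cong-≗ λ j → trans (indicator-sym i j) (sym (*-identityˡ (indicator j i))))
  (sum-indicatorˡ (λ _ → 1) i)

module _ {A : Set a} where
  open ≡-Reasoning

  copies : ∀ {k} → (Fin k → ℕ) → (Fin k → A) → List A
  copies m x = concat (tabulate λ i → replicate (m i) (x i))

  -- One additive function for three purposes: multiplicities (`count`), lengths (`weight-const1`)
  -- and the number of long blocks (`longs`).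
  weight : (A → ℕ) → List A → ℕ
  weight w xs = List.sum (map w xs)

  weight-++ : ∀ w xs ys → weight w (xs ++ ys) ≡ weight w xs + weight w ys
  weight-++ w []       ys = refl
  weight-++ w (x ∷ xs) ys = trans (cong (w x +_) (weight-++ w xs ys))
    (sym (+-assoc (w x) (weight w xs) (weight w ys)))

  weight-replicate : ∀ w n x → weight w (replicate n x) ≡ n * w x
  weight-replicate w zero    x = refl
  weight-replicate w (suc n) x = cong (w x +_) (weight-replicate w n x)

  weight-copies : ∀ w {k} (m : Fin k → ℕ) x → weight w (copies m x) ≡ sum (λ i → m i * w (x i))
  weight-copies w {zero}  m x = refl
  weight-copies w {suc k} m x = begin
    weight w (replicate (m zero) (x zero) ++ copies (m ∘ suc) (x ∘ suc))
      ≡⟨ weight-++ w (replicate (m zero) (x zero)) _ ⟩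
    weight w (replicate (m zero) (x zero)) + weight w (copies (m ∘ suc) (x ∘ suc))
      ≡⟨ cong₂ _+_ (weight-replicate w (m zero) (x zero)) (weight-copies w (m ∘ suc) (x ∘ suc)) ⟩
    m zero * w (x zero) + sum (λ i → m (suc i) * w (x (suc i))) ∎

  weight-const1 : ∀ xs → weight (λ _ → 1) xs ≡ length xs
  weight-const1 []       = refl
  weight-const1 (x ∷ xs) = cong suc (weight-const1 xs)

  length-copies : ∀ {k} (m : Fin k → ℕ) x → length (copies m x) ≡ sum m
  length-copies m x = begin
    length (copies m x)             ≡⟨ weight-const1 (copies m x) ⟨
    weight (λ _ → 1) (copies m x)   ≡⟨ weight-copies (λ _ → 1) m x ⟩
    sum (λ i → m i * 1)             ≡⟨ sum-cong-≗ (λ i → *-identityʳ (m i)) ⟩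
    sum m                           ∎

  All-copies : ∀ {P : A → Set r} {k} {m : Fin k → ℕ} {x : Fin k → A} →
    (∀ i → P (x i)) → All P (copies m x)
  All-copies Px = All.concat⁺ (All.tabulate⁺ λ i → All.replicate⁺ _ (Px i))

  weight-sum : ∀ {N} (f : A → Fin N → ℕ) xs →
    sum (λ i → weight (λ x → f x i) xs) ≡ weight (λ x → sum (f x)) xs
  weight-sum {N} f []   = sum-replicate-zero N
  weight-sum f (x ∷ xs) = trans (∑-distrib-+ (f x) (λ i → weight (λ x → f x i) xs))
    (cong (sum (f x) +_) (weight-sum f xs))

weight-cong : ∀ {A : Set a} {v w : A → ℕ} → (∀ x → v x ≡ w x) → ∀ xs → weight v xs ≡ weight w xs
weight-cong v≗w xs = cong List.sum (List.map-cong v≗w xs)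

weight-concat : ∀ {A : Set a} (w : A → ℕ) xss → weight w (concat xss) ≡ weight (weight w) xss
weight-concat w []         = refl
weight-concat w (xs ∷ xss) = trans (weight-++ w xs (concat xss)) (cong (weight w xs +_) (weight-concat w xss))

module Counting (S : Setoid a b) (N : ℕ) (card : HasCardinality S N) where
  open Setoid S using (Carrier; _≈_) renaming (refl to ≈-refl; sym to ≈-sym; trans to ≈-trans)
  open FreeAbelianMonoid S
  open Permutation S using (refl; prep; swap; ↭-refl; ↭-trans; ↭-prep) renaming (trans to transitive)
  open PermutationProperties S using (xs↭ys⇒|xs|≡|ys|)
  open ≡-Reasoning

  index : Carrier → Fin N
  index = Inverse.to card

  element : Fin N → Carrier
  element = Inverse.from card

  index-cong : ∀ {x y} → x ≈ y → index x ≡ index y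
  index-cong = Inverse.to-cong card

  index-element : ∀ i → index (element i) ≡ i
  index-element i = Inverse.strictlyInverseˡ card i

  index-injective : ∀ {x y} → index x ≡ index y → x ≈ y
  index-injective {x} {y} eq = ≈-trans (≈-sym (Inverse.strictlyInverseʳ card x))
    (≈-trans (Inverse.from-cong card eq) (Inverse.strictlyInverseʳ card y))

  -- A finite setoid has decidable equality through `index`, so lists up to permutation can be
  -- handled as vectors of multiplicities. This is applied both to G and to its set of atoms.
  count : List Carrier → Fin N → ℕ
  count xs i = weight (λ x → indicator (index x) i) xs

  count-++ : ∀ xs ys i → count (xs ++ ys) i ≡ count xs i + count ys i
  count-++ xs ys i = weight-++ _ xs ys

  sum-count : ∀ xs → sum (count xs) ≡ length xs
  sum-count xs = begin
    sum (count xs)                              ≡⟨ weight-sum (λ x i → indicator (index x) i) xs ⟩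
    weight (λ x → sum (indicator (index x))) xs ≡⟨ weight-cong (λ x → sum-indicator (index x)) xs ⟩
    weight (λ _ → 1) xs                         ≡⟨ weight-const1 xs ⟩
    length xs                                   ∎

  count≤length : ∀ xs i → count xs i ≤ length xs
  count≤length []       i = z≤n
  count≤length (x ∷ xs) i = +-mono-≤ (indicator≤1 (index x) i) (count≤length xs i)

  count-resp-↭ : ∀ {xs ys} → xs ↭ ys → ∀ i → count xs i ≡ count ys i
  count-resp-↭ (refl [])            i = refl
  count-resp-↭ (refl (eq ∷ eqs))    i =
    cong₂ _+_ (cong (λ j → indicator j i) (index-cong eq)) (count-resp-↭ (refl eqs) i)
  count-resp-↭ (prep eq p)          i =
    cong₂ _+_ (cong (λ j → indicator j i) (index-cong eq)) (count-resp-↭ p i)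
  count-resp-↭ (swap {xs} {ys} {x} {y} {x′} {y′} eq₁ eq₂ p) i = begin
    ι x + (ι y + count xs i)   ≡⟨ cong₂ _+_ (ι-cong eq₁) (cong₂ _+_ (ι-cong eq₂) (count-resp-↭ p i)) ⟩
    ι x′ + (ι y′ + count ys i) ≡⟨ swap₃ (ι x′) (ι y′) (count ys i) ⟩
    ι y′ + (ι x′ + count ys i) ∎
    where
    ι : Carrier → ℕ
    ι x = indicator (index x) i
    ι-cong : ∀ {x y} → x ≈ y → ι x ≡ ι y
    ι-cong eq = cong (λ j → indicator j i) (index-cong eq)
    swap₃ : ∀ x y z → x + (y + z) ≡ y + (x + z)
    swap₃ = solve-∀
  count-resp-↭ (transitive p q)     i = trans (count-resp-↭ p i) (count-resp-↭ q i)

  extract : ∀ xs x → 1 ≤ count xs (index x) → ∃[ zs ] x ∷ zs ↭ xs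
  extract (y ∷ ys) x 1≤ with index y Fin.≟ index x
  ... | yes eq = ys , prep (≈-sym (index-injective eq)) ↭-refl
  ... | no  _  = let zs , p = extract ys x 1≤ in
    y ∷ zs , ↭-trans (swap ≈-refl ≈-refl ↭-refl) (↭-prep y p)

  -- Induction on `xs`: its first term has positive multiplicity in `ys`, so `extract` brings a copy
  -- of it to the front of `ys`, where the two cancel.
  count-≗⇒↭ : ∀ xs ys → (∀ i → count xs i ≡ count ys i) → xs ↭ ys
  count-≗⇒↭ []       []       eq = ↭-refl
  count-≗⇒↭ []       (y ∷ ys) eq = contradiction
    (trans (eq (index y)) (cong (_+ count ys (index y)) (indicator-≡ {i = index y} refl))) λ ()
  count-≗⇒↭ (x ∷ xs) ys       eq =
    let zs , p = extract ys x (subst (1 ≤_)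
          (trans (cong (_+ count xs (index x)) (sym (indicator-≡ {i = index x} refl))) (eq (index x))) (s≤s z≤n))
    in ↭-trans (↭-prep x (count-≗⇒↭ xs zs λ i →
         +-cancelˡ-≡ (indicator (index x) i) _ _ (trans (eq i) (sym (count-resp-↭ p i))))) p

  multiset : (Fin N → ℕ) → List Carrier
  multiset v = copies v element

  count-multiset : ∀ v i → count (multiset v) i ≡ v i
  count-multiset v i = begin
    count (multiset v) i                                 ≡⟨ weight-copies _ v element ⟩
    sum (λ j → v j * indicator (index (element j)) i)    ≡⟨ sum-cong-≗ (λ j → cong (λ k → v j * indicator k i) (index-element j)) ⟩
    sum (λ j → v j * indicator j i)                      ≡⟨ sum-indicatorˡ v i ⟩
    v i                                                  ∎

  -- The truncated difference is the true cofactor exactly when `xs` divides `ys`.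
  complement : List Carrier → List Carrier → List Carrier
  complement xs ys = multiset (λ i → count ys i ∸ count xs i)

  complement-↭ : ∀ xs ys → (∀ i → count xs i ≤ count ys i) → xs ++ complement xs ys ↭ ys
  complement-↭ xs ys xs≤ys = count-≗⇒↭ (xs ++ complement xs ys) ys λ i → begin
    count (xs ++ complement xs ys) i       ≡⟨ count-++ xs (complement xs ys) i ⟩
    count xs i + count (complement xs ys) i ≡⟨ cong (count xs i +_) (count-multiset _ i) ⟩
    count xs i + (count ys i ∸ count xs i) ≡⟨ m+[n∸m]≡n (xs≤ys i) ⟩
    count ys i                             ∎

  count≤⇒∣ : ∀ xs ys → (∀ i → count xs i ≤ count ys i) → xs ∣ ys
  count≤⇒∣ xs ys xs≤ys = complement xs ys , complement-↭ xs ys xs≤ys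

  ∣⇒count≤ : ∀ {xs ys} → xs ∣ ys → ∀ i → count xs i ≤ count ys i
  ∣⇒count≤ {xs} {ys} (zs , p) i = subst (count xs i ≤_)
    (trans (sym (count-++ xs zs i)) (count-resp-↭ p i)) (m≤m+n _ _)

  -- Pointwise minima of multiplicities form a gcd, so a distance always exists, and cofactors are
  -- no longer than the lists themselves.
  distance : ∀ xs ys → ∃[ d ] IsDistance xs ys d × d ≤ length xs ⊔ length ys
  distance xs ys = _ ,
    (g , xs′ , ys′ , ((xs′ , px) , (ys′ , py) , greatest) , px , py , refl) ,
    ⊔-mono-≤ (cofactor≤ xs′ px) (cofactor≤ ys′ py)
    where
    g = multiset (λ i → count xs i ⊓ count ys i)
    xs′ = complement g xs
    ys′ = complement g ys
    px : g ++ xs′ ↭ xs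
    px = complement-↭ g xs λ i → ≤-trans (≤-reflexive (count-multiset _ i)) (m⊓n≤m _ _)
    py : g ++ ys′ ↭ ys
    py = complement-↭ g ys λ i → ≤-trans (≤-reflexive (count-multiset _ i)) (m⊓n≤n _ _)
    greatest : ∀ h → h ∣ xs → h ∣ ys → h ∣ g
    greatest h h∣xs h∣ys = count≤⇒∣ h g λ i → ≤-trans
      (⊓-glb (∣⇒count≤ h∣xs i) (∣⇒count≤ h∣ys i)) (≤-reflexive (sym (count-multiset _ i)))
    cofactor≤ : ∀ zs {ws} → g ++ zs ↭ ws → length zs ≤ length ws
    cofactor≤ zs p = ≤-trans (m≤n+m (length zs) (length g))
      (≤-reflexive (trans (sym (List.length-++ g)) (xs↭ys⇒|xs|≡|ys| p)))

  frequent : ∀ xs b → 1 ≤ N * b → N * b ≤ length xs → ∃[ i ] b ≤ count xs i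
  frequent xs b 1≤Nb Nb≤ = sum-pigeonhole (count xs) b 1≤Nb (subst (N * b ≤_) (sym (sum-count xs)) Nb≤)

-- Partitions into zero-sum blocks, and the descent from k + 1 to k

module ZeroSums {c ℓ} (G : AbelianGroup c ℓ) (n : ℕ) (order : HasOrder G n) where
  open AbelianGroup G
    using (Carrier; _≈_; _∙_; ε; _⁻¹; ∙-cong; ∙-congˡ; ∙-congʳ; identityˡ; identityʳ; inverseˡ; assoc; isCommutativeMonoid; rawMonoid)
    renaming (setoid to G-setoid; refl to ≈-refl; sym to ≈-sym; trans to ≈-trans) public
  open FreeAbelianMonoid G-setoid using (_↭_; _∣_) public
  open Permutation G-setoid using (↭-refl; ↭-sym; ↭-trans; ↭-prep; ↭-reflexive) public
  open PermutationProperties G-setoid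
    using (++⁺; ++⁺ˡ; ++⁺ʳ; ++-comm; shifts; dropMiddle; drop-∷; xs↭ys⇒|xs|≡|ys|; ¬x∷xs↭[]; foldr-commMonoid) public
  open Counting G-setoid n order public

  σ : List Carrier → Carrier
  σ = foldr _∙_ ε

  Block : List Carrier → Set (c L.⊔ ℓ)
  Block = NonEmptyZeroSum G

  σ-++ : ∀ xs ys → σ (xs ++ ys) ≈ σ xs ∙ σ ys
  σ-++ []       ys = ≈-sym (identityˡ (σ ys))
  σ-++ (x ∷ xs) ys = ≈-trans (∙-congˡ (σ-++ xs ys)) (≈-sym (assoc x (σ xs) (σ ys)))

  zeroSum-resp-↭ : ∀ {xs ys} → xs ↭ ys → ZeroSum G xs → ZeroSum G ys
  zeroSum-resp-↭ p zs = ≈-trans (≈-sym (foldr-commMonoid isCommutativeMonoid p)) zs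

  zeroSum-++ : ∀ {xs ys} → ZeroSum G xs → ZeroSum G ys → ZeroSum G (xs ++ ys)
  zeroSum-++ {xs} {ys} zx zy = ≈-trans (σ-++ xs ys) (≈-trans (∙-cong zx zy) (identityˡ ε))

  zeroSum-++⁻ʳ : ∀ xs {ys} → ZeroSum G xs → ZeroSum G (xs ++ ys) → ZeroSum G ys
  zeroSum-++⁻ʳ xs {ys} zx zxy = ≈-trans (≈-sym (≈-trans (∙-congʳ zx) (identityˡ (σ ys))))
    (≈-trans (≈-sym (σ-++ xs ys)) zxy)

  zeroSum-concat : ∀ {Ts} → All Block Ts → ZeroSum G (concat Ts)
  zeroSum-concat []                          = ≈-refl
  zeroSum-concat (_∷_ {T} {Ts} (_ , z) rest) = zeroSum-++ {T} {concat Ts} z (zeroSum-concat rest)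

  cofactor-zeroSum : ∀ T z {B} → ZeroSum G T → ZeroSum G B → T ++ z ↭ B → ZeroSum G z
  cofactor-zeroSum T z zT zB p = zeroSum-++⁻ʳ T zT (zeroSum-resp-↭ (↭-sym p) zB)

  block-resp-↭ : ∀ {xs ys} → xs ↭ ys → Block xs → Block ys
  block-resp-↭ {[]}    p (ne , z) = contradiction refl ne
  block-resp-↭ {x ∷ _} p (ne , z) = (λ { refl → ¬x∷xs↭[] p }) , zeroSum-resp-↭ p z

  length-block : ∀ {T} → Block T → 1 ≤ length T
  length-block {[]}    (ne , _) = contradiction refl ne
  length-block {_ ∷ _} _        = s≤s z≤n

  length-++-↭ : ∀ T z {B} → T ++ z ↭ B → length T + length z ≡ length B
  length-++-↭ T z p = trans (sym (List.length-++ T)) (xs↭ys⇒|xs|≡|ys| p)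

  -- In contrast to `DisjointZeroSums`, the blocks use up all of `B`. Together with `AtMost k B`
  -- this says that `k` is the optimal number of blocks.
  Splits : ℕ → List Carrier → Set (c L.⊔ ℓ)
  Splits k B = ∃[ Ts ] length Ts ≡ k × All Block Ts × concat Ts ↭ B

  AtMost : ℕ → List Carrier → Set (c L.⊔ ℓ)
  AtMost k B = ∀ j → Splits j B → j ≤ k

  splits-resp-↭ : ∀ {k B C} → B ↭ C → Splits k B → Splits k C
  splits-resp-↭ p (Ts , len , blocks , q) = Ts , len , blocks , ↭-trans q p

  atMost-resp-↭ : ∀ {k B C} → B ↭ C → AtMost k B → AtMost k C
  atMost-resp-↭ p most j sp = most j (splits-resp-↭ (↭-sym p) sp)

  splits-++ : ∀ {j k B C} → Splits j B → Splits k C → Splits (j + k) (B ++ C)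
  splits-++ {B = B} {C} (Ts , refl , bTs , p) (Us , refl , bUs , q) =
    Ts ++ Us , List.length-++ Ts , All.++⁺ bTs bUs ,
    ↭-trans (↭-reflexive (sym (List.concat-++ Ts Us))) (++⁺ p q)

  splits-concat : ∀ {Ts} → All Block Ts → Splits (length Ts) (concat Ts)
  splits-concat {Ts} blocks = Ts , refl , blocks , ↭-refl

  splits-block : ∀ {T} → Block T → Splits 1 T
  splits-block {T} b = T ∷ [] , refl , b ∷ [] , ↭-reflexive (List.++-identityʳ T)

  zeroSum⇒splits : ∀ {B} → ZeroSum G B → ∃[ k ] Splits k B
  zeroSum⇒splits {[]}    z = 0 , [] , refl , [] , ↭-refl
  zeroSum⇒splits {x ∷ B} z = 1 , splits-block ((λ ()) , z)

  length-concat : ∀ {Ts} → All Block Ts → length Ts ≤ length (concat Ts)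
  length-concat []                   = z≤n
  length-concat (_∷_ {T} {Ts} b bs) = ≤-trans (+-mono-≤ (length-block b) (length-concat bs))
    (≤-reflexive (sym (List.length-++ T)))

  splits≤length : ∀ {k B} → Splits k B → k ≤ length B
  splits≤length (Ts , refl , blocks , p) =
    ≤-trans (length-concat blocks) (≤-reflexive (xs↭ys⇒|xs|≡|ys| p))

  -- Any partition of `z`, joined to the given one of `T`, is a partition of `B`.
  atMost-cofactor : ∀ {i k T z B} → Splits i T → T ++ z ↭ B → AtMost (i + k) B → AtMost k z
  atMost-cofactor {i} sp p most j sz =
    +-cancelˡ-≤ i j _ (most (i + j) (splits-resp-↭ p (splits-++ sp sz)))

  -- A block that could be split would refine the whole partition; formally, all the other blocks
  -- are removed by `atMost-cofactor`.
  atMost⇒indecomposable : ∀ {Ts} → All Block Ts → AtMost (length Ts) (concat Ts) → All (AtMost 1) Ts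
  atMost⇒indecomposable []                 most = []
  atMost⇒indecomposable (_∷_ {T} {Ts} b bs) most =
    atMost-cofactor (splits-concat bs) (++-comm (concat Ts) T)
      (subst (λ k → AtMost k (T ++ concat Ts)) (+-comm 1 (length Ts)) most)
    ∷ atMost⇒indecomposable bs (atMost-cofactor (splits-block b) ↭-refl most)

  ¬¬-optimal : ∀ {B} → ZeroSum G B → ¬ ¬ (∃[ k ] Splits k B × AtMost k B)
  ¬¬-optimal {B} z = let k , sp = zeroSum⇒splits z in
    ¬¬-greatest (λ k → Splits k B) (length B) (λ _ → splits≤length) k sp

  disjoint-mono : ∀ {j k S} → k ≤ j → DisjointZeroSums G j S → DisjointZeroSums G k S
  disjoint-mono {k = k} k≤j (Ts , refl , blocks , z , p) =
    take k Ts , trans (List.length-take k Ts) (m≤n⇒m⊓n≡m k≤j) , All.take⁺ k blocks ,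
    concat (drop k Ts) ++ z , ↭-trans (↭-reflexive (begin
      concat (take k Ts) ++ concat (drop k Ts) ++ z   ≡⟨ List.++-assoc (concat (take k Ts)) _ z ⟨
      (concat (take k Ts) ++ concat (drop k Ts)) ++ z ≡⟨ cong (_++ z) (List.concat-++ (take k Ts) (drop k Ts)) ⟩
      concat (take k Ts ++ drop k Ts) ++ z            ≡⟨ cong (λ Us → concat Us ++ z) (List.take++drop≡id k Ts) ⟩
      concat Ts ++ z                                  ∎)) p
    where open ≡-Reasoning

  DProperty : ℕ → ℕ → Set (c L.⊔ ℓ)
  DProperty k l = ∀ S → l ≤ length S → DisjointZeroSums G k S

  -- A zero-sum sequence gains one block over its tail: whatever the k
  -- disjoint blocks leave over, together with the first term, is a block.
  DProperty⇒splits : ∀ {k l B} → DProperty k l → ZeroSum G B → suc l ≤ length B → Splits (suc k) B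
  DProperty⇒splits {B = x ∷ S} D z (s≤s l≤) with D S l≤
  ... | Ts , refl , blocks , rest , p =
    (x ∷ rest) ∷ Ts , refl ,
    ((λ ()) , cofactor-zeroSum (concat Ts) (x ∷ rest) (zeroSum-concat blocks) z q) ∷ blocks ,
    ↭-prep x (↭-trans (++-comm rest (concat Ts)) p)
    where
    q : concat Ts ++ x ∷ rest ↭ x ∷ S
    q = ↭-trans (++-comm (concat Ts) (x ∷ rest)) (↭-prep x (↭-trans (++-comm rest (concat Ts)) p))

  block-containing : ∀ x {Ts} → All Block Ts → 1 ≤ count (concat Ts) (index x) →
    ∃[ Us ] ∃[ z ] length Ts ≡ suc (length Us) × All Block Us × x ∷ z ++ concat Us ↭ concat Ts
  block-containing x (_∷_ {T} {Ts} b bs) 1≤ with 1 ≤? count T (index x)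
  ... | yes 1≤T = let z , p = extract T x 1≤T in Ts , z , refl , bs , ++⁺ʳ (concat Ts) p
  ... | no  1≰T =
    let Us , z , len , bUs , p = block-containing x bs (subst (1 ≤_)
          (trans (count-++ T (concat Ts) (index x)) (cong (_+ count (concat Ts) (index x)) (n<1⇒n≡0 (≰⇒> 1≰T)))) 1≤)
    in T ∷ Us , z , cong suc len , b ∷ bUs , ↭-trans (shifts (x ∷ z) T) (++⁺ˡ T p)

  -- Among more than `k` blocks only one uses the added term; discarding it leaves at least `k`
  -- disjoint blocks of `S`.
  ¬disjoint⇒atMost : ∀ {k} S → ¬ DisjointZeroSums G k S → AtMost k ((σ S) ⁻¹ ∷ S)
  ¬disjoint⇒atMost {k} S ¬disjoint j (Ts , refl , blocks , p) = ≮⇒≥ λ k<j →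
    let x = (σ S) ⁻¹
        Us , z , len , bUs , q = block-containing x blocks (subst (1 ≤_)
          (sym (trans (count-resp-↭ p (index x)) (cong (_+ count S (index x)) (indicator-≡ {i = index x} refl)))) (s≤s z≤n))
    in ¬disjoint (disjoint-mono (s≤s⁻¹ (≤-trans k<j (≤-reflexive len)))
         (Us , refl , bUs , z , ↭-trans (++-comm (concat Us) z) (drop-∷ (↭-trans q p))))

  σ⁻¹∷-zeroSum : ∀ S → ZeroSum G ((σ S) ⁻¹ ∷ S)
  σ⁻¹∷-zeroSum S = inverseˡ (σ S)

  -- Decidability of the existence of disjoint blocks.

  zeroSum? : ∀ S → Dec (ZeroSum G S)
  zeroSum? S = map′ index-injective index-cong (index (σ S) Fin.≟ index ε)

  block? : ∀ S → Dec (Block S)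
  block? []      = no λ b → proj₁ b refl
  block? (x ∷ S) = map′ ((λ ()) ,_) proj₂ (zeroSum? (x ∷ S))

  -- A divisor of `S` is determined up to permutation by multiplicities of at most `length S`, so
  -- finitely many vectors have to be searched; `resp` makes the search independent of the order of
  -- terms.
  splitting? : ∀ {q} {Q : List Carrier → List Carrier → Set q} →
    (∀ {T U z w} → T ↭ U → z ↭ w → Q T z → Q U w) → (∀ T z → Dec (Q T z)) →
    ∀ S → Dec (∃[ T ] ∃[ z ] T ++ z ↭ S × Q T z)
  splitting? {Q = Q} resp Q? S = map′ sound complete (Fin.any? λ i →
      Fin.all? (λ g → count (sub i) g ≤? count S g) ×-dec Q? (sub i) (complement (sub i) S))
    where
    vector : Fin (suc (length S) ^ n) → Fin n → ℕ
    vector i g = toℕ (finToFun i g)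
    sub : Fin (suc (length S) ^ n) → List Carrier
    sub i = multiset (vector i)
    sound : ∃[ i ] (∀ g → count (sub i) g ≤ count S g) × Q (sub i) (complement (sub i) S) →
      ∃[ T ] ∃[ z ] T ++ z ↭ S × Q T z
    sound (i , sub≤S , q) = sub i , complement (sub i) S , complement-↭ (sub i) S sub≤S , q
    complete : ∃[ T ] ∃[ z ] T ++ z ↭ S × Q T z →
      ∃[ i ] (∀ g → count (sub i) g ≤ count S g) × Q (sub i) (complement (sub i) S)
    complete (T , z , p , q) = i , sub≤S , resp (↭-sym sub↭T) (↭-sym z↭) q
      where
      T<S : ∀ g → count T g < suc (length S)
      T<S g = s≤s (≤-trans (count≤length T g)
        (≤-trans (m≤m+n (length T) (length z)) (≤-reflexive (length-++-↭ T z p))))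
      i : Fin (suc (length S) ^ n)
      i = funToFin λ g → fromℕ< (T<S g)
      count-sub : ∀ g → count (sub i) g ≡ count T g
      count-sub g = trans (count-multiset (vector i) g)
        (trans (cong toℕ (Fin.finToFun-funToFin (λ g → fromℕ< (T<S g)) g)) (Fin.toℕ-fromℕ< (T<S g)))
      sub↭T : sub i ↭ T
      sub↭T = count-≗⇒↭ (sub i) T count-sub
      sub≤S : ∀ g → count (sub i) g ≤ count S g
      sub≤S g = ≤-trans (≤-reflexive (count-sub g)) (∣⇒count≤ (z , p) g)
      z↭ : complement (sub i) S ↭ z
      z↭ = dropMiddle {vs = sub i} [] []
        (↭-trans (complement-↭ (sub i) S sub≤S) (↭-trans (↭-sym p) (++⁺ʳ z (↭-sym sub↭T))))

  disjoint-resp-↭ : ∀ {k S S′} → S ↭ S′ → DisjointZeroSums G k S → DisjointZeroSums G k S′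
  disjoint-resp-↭ p (Ts , len , blocks , z , q) = Ts , len , blocks , z , ↭-trans q p

  -- `DProperty` asks for actual blocks, whereas the descent only refutes their absence; this
  -- decision bridges the gap.
  disjoint? : ∀ k S → Dec (DisjointZeroSums G k S)
  disjoint? zero    S = yes ([] , refl , [] , S , ↭-refl)
  disjoint? (suc k) S = map′ cons uncons (splitting?
      (λ p q (b , d) → block-resp-↭ p b , disjoint-resp-↭ q d)
      (λ T z → block? T ×-dec disjoint? k z) S)
    where
    cons : ∃[ T ] ∃[ z ] T ++ z ↭ S × Block T × DisjointZeroSums G k z → DisjointZeroSums G (suc k) S
    cons (T , z , p , b , Ts , len , blocks , w , q) = T ∷ Ts , cong suc len , b ∷ blocks , w ,
      ↭-trans (↭-reflexive (List.++-assoc T (concat Ts) w)) (↭-trans (++⁺ˡ T q) p)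
    uncons : DisjointZeroSums G (suc k) S → ∃[ T ] ∃[ z ] T ++ z ↭ S × Block T × DisjointZeroSums G k z
    uncons (T ∷ Ts , len , b ∷ blocks , w , q) = T , concat Ts ++ w ,
      ↭-trans (↭-reflexive (sym (List.++-assoc T (concat Ts) w))) q , b ,
      Ts , suc-injective len , blocks , w , ↭-refl

  -- Long blocks and the descent step.

  module Descent (e : ℕ) (1≤e : 1 ≤ e) where

    EtaProperty : ℕ → Set (c L.⊔ ℓ)
    EtaProperty h = ∀ S → h ≤ length S → ∃[ T ] T ∣ S × Block T × length T ≤ e

    long : List Carrier → ℕ
    long T = if does (e ≤? length T) then 1 else 0

    long-≥ : ∀ {T} → e ≤ length T → long T ≡ 1
    long-≥ {T} e≤T = cong (λ b → if b then 1 else 0) (dec-true (e ≤? length T) e≤T)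

    long-< : ∀ {T} → ¬ e ≤ length T → long T ≡ 0
    long-< {T} e≰T = cong (λ b → if b then 1 else 0) (dec-false (e ≤? length T) e≰T)

    longs : List (List Carrier) → ℕ
    longs = weight long

    -- While at least `h` terms remain, η yields a block of length at most `e`, and removing it
    -- lowers the bound `j` by one. The claim is |B| ≤ (j - 1) e + h written without subtraction;
    -- for j = 0, where `B` is empty, it reads `e ≤ h`.
    length≤ : ∀ {h} → EtaProperty h → e ≤ h → ∀ j {B} → ZeroSum G B → AtMost j B → length B + e ≤ j * e + h
    length≤ {h} η e≤h j {B} zB most with h ≤? length B
    length≤ {h} η e≤h zero    {[]}    zB most | no  _   = e≤h
    length≤ {h} η e≤h zero    {x ∷ B} zB most | no  _   =
      contradiction (most 1 (splits-block ((λ ()) , zB))) λ ()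
    length≤ {h} η e≤h (suc j) {B}     zB most | no  h≰B = begin
      length B + e      ≤⟨ +-monoˡ-≤ e (<⇒≤ (≰⇒> h≰B)) ⟩
      h + e             ≡⟨ +-comm h e ⟩
      e + h             ≤⟨ +-monoˡ-≤ h (m≤m+n e (j * e)) ⟩
      e + j * e + h     ∎
      where open ≤-Reasoning
    length≤ {h} η e≤h j {B} zB most | yes h≤B with η B h≤B
    length≤ {h} η e≤h zero    {B} zB most | yes h≤B | T , (z , p) , b , T≤e =
      contradiction (≤-trans (m≤m+n 1 _) (most _ (splits-resp-↭ p
        (splits-++ (splits-block b) (proj₂ (zeroSum⇒splits (cofactor-zeroSum T z (proj₂ b) zB p))))))) λ ()
    length≤ {h} η e≤h (suc j) {B} zB most | yes h≤B | T , (z , p) , b , T≤e = begin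
      length B + e              ≡⟨ cong (_+ e) (length-++-↭ T z p) ⟨
      length T + length z + e   ≡⟨ +-assoc (length T) (length z) e ⟩
      length T + (length z + e) ≤⟨ +-mono-≤ T≤e (length≤ η e≤h j (cofactor-zeroSum T z (proj₂ b) zB p)
                                     (atMost-cofactor (splits-block b) p most)) ⟩
      e + (j * e + h)           ≡⟨ +-assoc e (j * e) h ⟨
      e + j * e + h             ∎
      where open ≤-Reasoning

    separate : ∀ {Ts} → All Block Ts → ∃[ Ls ] ∃[ Ss ]
      All Block Ls × All Block Ss × All (λ T → length T < e) Ss × concat Ss ++ concat Ls ↭ concat Ts ×
      length Ls ≡ longs Ts × length Ss + length Ls ≡ length Ts
    separate [] = [] , [] , [] , [] , [] , ↭-refl , refl , refl
    separate (_∷_ {T} {Ts} b bs) with separate bs | e ≤? length T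
    ... | Ls , Ss , bLs , bSs , short , p , eq₁ , eq₂ | yes e≤T =
      T ∷ Ls , Ss , b ∷ bLs , bSs , short , ↭-trans (shifts (concat Ss) T) (++⁺ˡ T p) ,
      trans (cong suc eq₁) (cong (_+ longs Ts) (sym (long-≥ {T} e≤T))) , trans (+-suc (length Ss) (length Ls)) (cong suc eq₂)
    ... | Ls , Ss , bLs , bSs , short , p , eq₁ , eq₂ | no  e≰T =
      Ls , T ∷ Ss , bLs , b ∷ bSs , ≰⇒> e≰T ∷ short ,
      ↭-trans (↭-reflexive (List.++-assoc T (concat Ss) (concat Ls))) (++⁺ˡ T p) ,
      trans eq₁ (cong (_+ longs Ts) (sym (long-< {T} e≰T))) , cong suc eq₂

    length-short : ∀ {Ss : List (List Carrier)} → All (λ T → length T < e) Ss → length (concat Ss) + length Ss ≤ length Ss * e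
    length-short []                      = z≤n
    length-short (_∷_ {T} {Ss} T<e short) = begin
      length (T ++ concat Ss) + suc (length Ss)          ≡⟨ cong (_+ suc (length Ss)) (List.length-++ T) ⟩
      length T + length (concat Ss) + suc (length Ss)    ≡⟨ rearrange (length T) (length (concat Ss)) (length Ss) ⟩
      suc (length T) + (length (concat Ss) + length Ss)  ≤⟨ +-mono-≤ T<e (length-short short) ⟩
      e + length Ss * e                                  ∎
      where
      open ≤-Reasoning
      rearrange : ∀ t u s → t + u + suc s ≡ suc t + (u + s)
      rearrange = solve-∀

    -- The long blocks of an optimal partition form an optimal partition
    -- themselves, so length≤ bounds their total length.
    length-optimal : ∀ {h} → EtaProperty h → e ≤ h → ∀ {Ts} → All Block Ts → AtMost (length Ts) (concat Ts) →
      length (concat Ts) + e + length Ts ≤ length Ts * e + h + longs Ts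
    length-optimal {h} η e≤h {Ts} blocks most with separate blocks
    ... | Ls , Ss , bLs , bSs , short , p , eq₁ , eq₂ = begin
      length (concat Ts) + e + length Ts
        ≡⟨ cong₂ (λ x y → x + e + y) (length-++-↭ (concat Ss) (concat Ls) p) eq₂ ⟨
      length (concat Ss) + length (concat Ls) + e + (length Ss + length Ls)
        ≡⟨ rearrange (length (concat Ss)) (length (concat Ls)) e (length Ss) (length Ls) ⟩
      (length (concat Ss) + length Ss) + (length (concat Ls) + e) + length Ls
        ≤⟨ +-monoˡ-≤ (length Ls) (+-mono-≤ (length-short short)
             (length≤ η e≤h (length Ls) (zeroSum-concat bLs)
               (atMost-cofactor (splits-concat bSs) p (subst (λ k → AtMost k (concat Ts)) (sym eq₂) most)))) ⟩
      length Ss * e + (length Ls * e + h) + length Ls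
        ≡⟨ cong (_+ length Ls) (+-assoc (length Ss * e) (length Ls * e) h) ⟨
      length Ss * e + length Ls * e + h + length Ls
        ≡⟨ cong₂ (λ x y → x + h + y) (trans (sym (*-distribʳ-+ e (length Ss) (length Ls))) (cong (_* e) eq₂)) eq₁ ⟩
      length Ts * e + h + longs Ts ∎
      where
      open ≤-Reasoning
      rearrange : ∀ a b e s l → a + b + e + (s + l) ≡ (a + s) + (b + e) + l
      rearrange = solve-∀

    -- This isolates what the two bounds do differently: how many long blocks guarantee one that can
    -- be added. The count is demanded of every partition into `k` blocks, so that an argument may
    -- exchange the given partition for another of the same size.
    Pump : ℕ → Set (c L.⊔ ℓ)
    Pump Q = ∀ B k → ZeroSum G B → Splits k B → AtMost k B →
      (∀ Ts → All Block Ts → concat Ts ↭ B → length Ts ≡ k → Q ≤ longs Ts) →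
      ¬ ¬ (∃[ U ] Block U × e ≤ length U × AtMost (suc k) (U ++ B))

    -- Solves the inequality of `length-optimal` for the number `L` of long blocks. With k = j + i,
    -- an optimum that falls short of `k` by `i` only helps, because i ≤ i e.
    many-long : ∀ {Q h d₀ k j L b} → Q + h ≤ k + suc d₀ + e → j ≤ k → suc (d₀ + k * e) ≤ b →
      b + e + j ≤ j * e + h + L → Q ≤ L
    many-long {Q} {h} {d₀} {k} {j} {L} {b} Q+h≤ j≤k ≤b b+e+j≤ with m≤n⇒∃[o]m+o≡n j≤k
    ... | i , refl = +-cancelʳ-≤ h Q L (≤-trans Q+h≤ (+-cancelˡ-≤ (j * e) _ _ (begin
      j * e + (j + i + suc d₀ + e)        ≤⟨ +-monoʳ-≤ (j * e) (+-monoˡ-≤ e (+-monoˡ-≤ (suc d₀)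
                                               (+-monoʳ-≤ j (m≤m*n i e {{>-nonZero 1≤e}})))) ⟩
      j * e + (j + i * e + suc d₀ + e)    ≡⟨ rearrange j e i d₀ ⟩
      suc (d₀ + (j + i) * e) + e + j      ≤⟨ +-monoˡ-≤ j (+-monoˡ-≤ e ≤b) ⟩
      b + e + j                           ≤⟨ b+e+j≤ ⟩
      j * e + h + L                       ≡⟨ +-assoc (j * e) h L ⟩
      j * e + (h + L)                     ≡⟨ cong (j * e +_) (+-comm h L) ⟩
      j * e + (L + h)                     ∎)))
      where
      open ≤-Reasoning
      rearrange : ∀ j e i d → j * e + (j + i * e + suc d + e) ≡ suc (d + (j + i) * e) + e + j
      rearrange = solve-∀

    module _ (Q h d₀ : ℕ) (η : EtaProperty h) (e≤h : e ≤ h) (pump : Pump Q) where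

      descend-DProperty : ∀ k → Q + h ≤ k + suc d₀ + e →
        DProperty (suc k) (d₀ + suc k * e) → DProperty k (d₀ + k * e)
      descend-DProperty k Q+h≤ D S ≤S with disjoint? k S
      ... | yes d  = d
      ... | no  ¬d = contradiction (λ (j , sp , most) → impossible j sp most) (¬¬-optimal zB)
        where
        B = (σ S) ⁻¹ ∷ S
        zB = σ⁻¹∷-zeroSum S
        B≤k : AtMost k B
        B≤k = ¬disjoint⇒atMost S ¬d
        ≤B : suc (d₀ + k * e) ≤ length B
        ≤B = s≤s ≤S
        impossible : ∀ j → Splits j B → ¬ AtMost j B
        -- `U ++ B` has more than d₀ + (k + 1) e terms, hence k + 2 blocks by `DProperty⇒splits`,
        -- while its optimum is at most j + 1 ≤ k + 1.
        impossible j sp most = pump B j zB sp most enough λ (U , bU , e≤U , mostU) →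
          <⇒≱ (s≤s (s≤s (B≤k j sp))) (mostU (suc (suc k))
            (DProperty⇒splits D (zeroSum-++ {U} {B} (proj₂ bU) zB) (begin
              suc (d₀ + (e + k * e))  ≡⟨ rearrange d₀ e (k * e) ⟩
              e + suc (d₀ + k * e)    ≤⟨ +-mono-≤ e≤U ≤B ⟩
              length U + length B     ≡⟨ List.length-++ U ⟨
              length (U ++ B)         ∎)))
          where
          open ≤-Reasoning
          rearrange : ∀ d e m → suc (d + (e + m)) ≡ e + suc (d + m)
          rearrange = solve-∀
          enough : ∀ Ts → All Block Ts → concat Ts ↭ B → length Ts ≡ j → Q ≤ longs Ts
          enough Ts blocks p refl = many-long Q+h≤ (B≤k j sp)
            (≤-trans ≤B (≤-reflexive (sym (xs↭ys⇒|xs|≡|ys| p))))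
            (length-optimal η e≤h blocks (atMost-resp-↭ (↭-sym p) most))

      -- A block of length at most `e` is split off by η, and `D` finds `k` more in the rest. This
      -- carries minimality downwards: a value below d₀ + k e for k would give one below d₀ + (k +
      -- 1) e for k + 1.
      ascend-DProperty : ∀ {k l} → h ≤ l + e → DProperty k l → DProperty (suc k) (l + e)
      ascend-DProperty {k} {l} h≤ D S ≤S with η S (≤-trans h≤ ≤S)
      ... | T , (z , p) , b , T≤e with D z (+-cancelʳ-≤ e l (length z) (begin
        l + e               ≤⟨ ≤S ⟩
        length S            ≡⟨ length-++-↭ T z p ⟨
        length T + length z ≤⟨ +-monoˡ-≤ (length z) T≤e ⟩
        e + length z        ≡⟨ +-comm e (length z) ⟩
        length z + e        ∎))
        where open ≤-Reasoning
      ... | Ts , refl , blocks , w , q = T ∷ Ts , refl , b ∷ blocks , w ,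
        ↭-trans (↭-reflexive (List.++-assoc T (concat Ts) w)) (↭-trans (++⁺ˡ T q) p)

      DFormula-from : ∀ {K} → 1 ≤ K → (∀ k → K ≤ k → Q + h ≤ k + suc d₀ + e) →
        (∀ k l → K ≤ k → DProperty k l → h ≤ l + e) →
        IsD₀ G e d₀ → DFormulaFrom G e d₀ K
      -- At k₁ + k the formula is known; k₁ descents lead back to k.
      DFormula-from {K} 1≤K Q+h≤ h≤l+e (k₁ , _ , formula) = 1≤K , λ k K≤k → down k₁ k K≤k (formula (k₁ + k) (m≤m+n k₁ k))
        where
        step : ∀ k → K ≤ k → IsD G (suc k) (d₀ + suc k * e) → IsD G k (d₀ + k * e)
        step k K≤k (D , least) = descend-DProperty k (Q+h≤ k K≤k) D , λ l Dl →
          +-cancelʳ-≤ e (d₀ + k * e) l (≤-trans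
            (≤-reflexive (trans (+-assoc d₀ (k * e) e) (cong (d₀ +_) (+-comm (k * e) e))))
            (least (l + e) (ascend-DProperty (h≤l+e k l K≤k Dl) Dl)))
        down : ∀ i k → K ≤ k → IsD G (i + k) (d₀ + (i + k) * e) → IsD G k (d₀ + k * e)
        down zero    k K≤k isD = isD
        down (suc i) k K≤k isD = down i k K≤k (step (i + k) (≤-trans K≤k (m≤n+m k i)) isD)

-- The bound in terms of δ(G)

weight-filter≤ : ∀ {a p} {A : Set a} {P : A → Set p} (P? : Decidable P) w xs →
  weight w (filter P? xs) ≤ weight w xs
weight-filter≤ P? w []       = z≤n
weight-filter≤ P? w (x ∷ xs) with P? x
... | yes _ = +-monoʳ-≤ (w x) (weight-filter≤ P? w xs)
... | no  _ = ≤-trans (weight-filter≤ P? w xs) (m≤n+m _ (w x))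

IsD-positive : ∀ {c ℓ} (G : AbelianGroup c ℓ) {d} → IsD G 1 d → 1 ≤ d
IsD-positive G {suc d} _ = s≤s z≤n
IsD-positive G {zero}  (D , _) with D [] z≤n
... | [] ∷ [] , refl , (nonempty , _) ∷ [] , _ = contradiction refl nonempty
... | (_ ∷ _) ∷ [] , refl , _ , _ , p =
  contradiction p (PermutationProperties.¬x∷xs↭[] (AbelianGroup.setoid G))

module Factorizations {c ℓ} (G : AbelianGroup c ℓ) (n : ℕ) (order : HasOrder G n) (e : ℕ) (1≤e : 1 ≤ e) where
  open ZeroSums G n order
  open Descent e 1≤e
  open Permutation (𝒜 G) using (refl; prep; swap) renaming (_↭_ to _↭ᶠ_; trans to transitive)

  -- A zero-sum divisor with non-empty cofactor would split `T` into two blocks, and an empty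
  -- cofactor makes the divisor all of `T`.
  indecomposable⇒minimal : ∀ {T} → Block T → AtMost 1 T → MinimalZeroSum G T
  indecomposable⇒minimal {T} b most = b , λ where
    (U , ([] , p) , U≉T , _) → U≉T (↭-trans (↭-reflexive (sym (List.++-identityʳ U))) p)
    (U , (x ∷ z , p) , _ , bU) → contradiction
      (most 2 (splits-resp-↭ p (splits-++ (splits-block bU)
        (splits-block ((λ ()) , cofactor-zeroSum U (x ∷ z) (proj₂ bU) (proj₂ b) p)))))
      λ { (s≤s ()) }

  atoms : ∀ {Ts} → All Block Ts → All (AtMost 1) Ts → Σ[ ζ ∈ Factorization G ] map proj₁ ζ ≡ Ts
  atoms []                  []          = [] , refl
  atoms (_∷_ {T} b blocks) (most ∷ ms) = let ζ , eq = atoms blocks ms in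
    (T , indecomposable⇒minimal b most) ∷ ζ , cong (T ∷_) eq

  -- Here partitions meet δ(G): blocks of an optimal partition are indecomposable, hence atoms.
  optimal⇒factorization : ∀ {k B} → Splits k B → AtMost k B →
    ∃[ ζ ] length ζ ≡ k × All Block (map proj₁ ζ) × π G ζ ↭ B
  optimal⇒factorization (Ts , refl , blocks , p) most
    with atoms blocks (atMost⇒indecomposable blocks (atMost-resp-↭ (↭-sym p) most))
  ... | ζ , refl = ζ , sym (List.length-map proj₁ ζ) , blocks , p

  blocks-of : ∀ (ζ : Factorization G) → All Block (map proj₁ ζ)
  blocks-of []      = []
  blocks-of (U ∷ ζ) = proj₁ (proj₂ U) ∷ blocks-of ζ

  splits-π : ∀ ζ → Splits (length ζ) (π G ζ)
  splits-π ζ = map proj₁ ζ , List.length-map proj₁ ζ , blocks-of ζ , ↭-refl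

  π-resp-↭ : ∀ {ζ ξ} → ζ ↭ᶠ ξ → π G ζ ↭ π G ξ
  π-resp-↭ (refl [])                   = ↭-refl
  π-resp-↭ (refl (p ∷ ps))             = ++⁺ p (π-resp-↭ (refl ps))
  π-resp-↭ (prep p q)                  = ++⁺ p (π-resp-↭ q)
  π-resp-↭ (swap {x = U} {V} p₁ p₂ q)  =
    ↭-trans (shifts (proj₁ U) (proj₁ V)) (++⁺ p₂ (++⁺ p₁ (π-resp-↭ q)))
  π-resp-↭ (transitive p q)            = ↭-trans (π-resp-↭ p) (π-resp-↭ q)

  IsLong : Atom G → Set
  IsLong U = e ≤ length (proj₁ U)

  isLong? : Decidable IsLong
  isLong? U = e ≤? length (proj₁ U)

  longs≡length-filter : ∀ ζ → longs (map proj₁ ζ) ≡ length (filter isLong? ζ)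
  longs≡length-filter []      = refl
  longs≡length-filter (U ∷ ζ) with e ≤ᵇ length (proj₁ U)
  ... | true  = cong suc (longs≡length-filter ζ)
  ... | false = longs≡length-filter ζ

  module _ (δ N : ℕ) (isDelta : IsDelta G δ) (card : HasCardinality (𝒜 G) N) where
    private module 𝒜# = Counting (𝒜 G) N card

    -- Pigeonhole over the `N` atoms, applied to the long ones only. The additional 1 serves the
    -- case δ = 0, where no repetition is required but a long atom still has to exist.
    frequent-long : ∀ ζ → 1 + δ * N ≤ longs (map proj₁ ζ) →
      ∃[ U ] IsLong U × δ ≤ 𝒜#.count ζ (𝒜#.index U)
    frequent-long ζ ≤longs with filter isLong? ζ in eq | subst (1 + δ * N ≤_) (longs≡length-filter ζ) ≤longs
    ... | V ∷ ζₗ | ≤ζₗ = search δ ≤ζₗ (subst (All IsLong) eq (All.all-filter isLong? ζ))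
      where
      open PermutationProperties (𝒜 G) using (All-resp-↭)
      search : ∀ δ → 1 + δ * N ≤ length (V ∷ ζₗ) → All IsLong (V ∷ ζₗ) →
        ∃[ U ] IsLong U × δ ≤ 𝒜#.count ζ (𝒜#.index U)
      search zero    _ (e≤V ∷ _) = V , e≤V , z≤n
      search (suc δ) ≤ζₗ allLong with 𝒜#.frequent (V ∷ ζₗ) (suc δ) (1≤N* N (𝒜#.index V))
          (≤-trans (≤-reflexive (*-comm N (suc δ))) (≤-trans (n≤1+n _) ≤ζₗ))
        where
        1≤N* : ∀ N → Fin N → 1 ≤ N * suc δ
        1≤N* (suc N) _ = s≤s z≤n
      ... | i , δ<count = U ,
            All.head (All-resp-↭ (λ p → subst (e ≤_) (xs↭ys⇒|xs|≡|ys| p)) (Permutation.↭-sym (𝒜 G) (proj₂ U∷)) allLong) ,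
            ≤-trans count≥ (subst (λ ζₗ → 𝒜#.count ζₗ (𝒜#.index U) ≤ 𝒜#.count ζ (𝒜#.index U)) eq
              (weight-filter≤ isLong? _ ζ))
        where
        U = 𝒜#.element i
        count≥ : suc δ ≤ 𝒜#.count (V ∷ ζₗ) (𝒜#.index U)
        count≥ = subst (λ j → suc δ ≤ 𝒜#.count (V ∷ ζₗ) j) (sym (𝒜#.index-element i)) δ<count
        U∷ : ∃[ zs ] U ∷ zs ↭ᶠ V ∷ ζₗ
        U∷ = 𝒜#.extract (V ∷ ζₗ) U (≤-trans (s≤s z≤n) count≥)

    -- `IsDelta` bounds those local values that exist. One exists because distances are bounded: no
    -- factorization of π(ζ) has more atoms than π(ζ) has terms.
    ¬¬-localDelta : ∀ ζ → ¬ ¬ (∃[ r ] IsLocalDelta G ζ r)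
    ¬¬-localDelta ζ = ¬¬-least _ (length (π G ζ)) λ where
      k _ (_ , (ξ , p , len) , _) → let d , dist , d≤ = 𝒜#.distance ξ ζ in
        ξ , p , len , d , dist , ≤-trans d≤ (⊔-lub
          (splits≤length (splits-resp-↭ p (splits-π ξ))) (splits≤length (splits-π ζ)))

    -- At most δ atoms of `ζ` lie outside the gcd, so one of the more than δ copies of `U` lies
    -- inside it and hence in `ξ`.
    common-atom : ∀ {ζ ξ d} U → FreeAbelianMonoid.IsDistance (𝒜 G) ξ ζ d → d ≤ δ →
      δ < 𝒜#.count ζ (𝒜#.index U) → ∃[ ξ′ ] U ∷ ξ′ ↭ᶠ ξ
    common-atom {ζ} {ξ} U (g , x′ , y′ , _ , px , py , refl) d≤δ δ<ζ =
      𝒜#.extract ξ U (≤-trans 1≤g (𝒜#.∣⇒count≤ (x′ , px) i))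
      where
      i = 𝒜#.index U
      1≤g : 1 ≤ 𝒜#.count g i
      1≤g = +-cancelʳ-≤ δ 1 (𝒜#.count g i) (begin
        suc δ                           ≤⟨ δ<ζ ⟩
        𝒜#.count ζ i                    ≡⟨ 𝒜#.count-resp-↭ py i ⟨
        𝒜#.count (g ++ y′) i            ≡⟨ 𝒜#.count-++ g y′ i ⟩
        𝒜#.count g i + 𝒜#.count y′ i    ≤⟨ +-monoʳ-≤ (𝒜#.count g i) (begin
          𝒜#.count y′ i                   ≤⟨ 𝒜#.count≤length y′ i ⟩
          length y′                       ≤⟨ m≤n⊔m (length x′) (length y′) ⟩
          length x′ ⊔ length y′           ≤⟨ d≤δ ⟩
          δ                               ∎) ⟩
        𝒜#.count g i + δ                ∎)
        where open ≤-Reasoning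

    pump-δ : Pump (1 + δ * N)
    pump-δ B k zB sp most enough none with optimal⇒factorization sp most
    ... | ζ , refl , blocks , p
      with frequent-long ζ (enough (map proj₁ ζ) blocks p (List.length-map proj₁ ζ))
    ... | U , e≤U , δ≤count = none (proj₁ U , bU , e≤U , bound)
      where
      bU = proj₁ (proj₂ U)
      ζ⁺ : Factorization G
      ζ⁺ = U ∷ ζ
      p⁺ : π G ζ⁺ ↭ proj₁ U ++ B
      p⁺ = ++⁺ˡ (proj₁ U) p
      δ<ζ⁺ : δ < 𝒜#.count ζ⁺ (𝒜#.index U)
      δ<ζ⁺ = ≤-trans (s≤s δ≤count) (≤-reflexive (cong (_+ 𝒜#.count ζ (𝒜#.index U)) (sym (indicator-≡ {i = 𝒜#.index U} refl))))

      -- The least length above that of `ζ⁺` is adjacent to it, which is the situation that δ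
      -- governs.
      LongerLength : ℕ → Set (c L.⊔ ℓ)
      LongerLength m = suc (length ζ) < m × _∈L_ G m (π G ζ⁺)

      adjacent : ∀ {m} → IsLeast LongerLength m → Adjacent G (π G ζ⁺) (length ζ⁺) m
      adjacent {m} ((ζ⁺<m , m∈L) , least) = (ζ⁺ , ↭-refl , refl) , m∈L , <⇒≢ ζ⁺<m , λ where
        (j , j∈L , inj₁ (ζ⁺<j , j<m)) → <⇒≱ j<m (least j (ζ⁺<j , j∈L))
        (j , j∈L , inj₂ (m<j , j<ζ⁺)) → <-asym ζ⁺<m (<-trans m<j j<ζ⁺)

      no-longer : ∀ {m} → LongerLength m → ¬ ¬ ¬ (∃[ m ] IsLeast LongerLength m)
      no-longer {m} longer ¬none = ¬¬-localDelta ζ⁺ λ (r , isLocal) → ¬none λ (m , isLeast) →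
        let ξ , q , len , d , dist , d≤r =
              proj₁ isLocal m (≤-trans (s≤s z≤n) (proj₁ (proj₁ isLeast))) (adjacent isLeast)
            ξ′ , q′ = common-atom {ζ⁺} {ξ} U dist (≤-trans d≤r (proj₁ isDelta ζ⁺ r isLocal)) δ<ζ⁺
            -- Cancelling `U` leaves a factorization of `B` with m - 1 > |ζ| atoms, against the
            -- optimality of `ζ`.
            ξ′↭B = dropMiddle {vs = proj₁ U} [] [] (↭-trans (π-resp-↭ q′) (↭-trans q p⁺))
        in <⇒≱ (proj₁ (proj₁ isLeast)) (begin
             m                  ≡⟨ len ⟨
             length ξ           ≡⟨ PermutationProperties.xs↭ys⇒|xs|≡|ys| (𝒜 G) q′ ⟨
             suc (length ξ′)    ≤⟨ s≤s (most (length ξ′) (splits-resp-↭ ξ′↭B (splits-π ξ′))) ⟩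
             suc (length ζ)     ∎)
        where open ≤-Reasoning

      bound : AtMost (suc (length ζ)) (proj₁ U ++ B)
      bound j sj = ≮⇒≥ λ ζ⁺<j →
        -- The larger partition need not consist of atoms; an optimal one does, and so provides a
        -- longer length.
        ¬¬-optimal (zeroSum-++ {proj₁ U} {B} (proj₂ bU) zB) λ (j* , sp* , most*) →
          let ξ , len , _ , q = optimal⇒factorization sp* most*
              longer = ≤-trans ζ⁺<j (most* j sj) , ξ , ↭-trans q (↭-sym p⁺) , len
          in no-longer longer (¬¬-least LongerLength j* longer)

  -- Lower bounds for D_k(G) in terms of D(G⁻).

  module _ {c′ ℓ′} (H : AbelianGroup c′ ℓ′) (iso : IsMinusPart G e H) (1<e : 1 < e)
           (d⁻ : ℕ) (isD : IsD H 1 d⁻) where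
    private
      module H = AbelianGroup H
      module C = AbelianGroup (Cyclic e)
      module H↭ = Permutation H.setoid
      module H↭P = PermutationProperties H.setoid
    open GroupMorphisms.IsGroupIsomorphism (proj₂ iso) using (surjective; ⟦⟧-cong; ∙-homo; ε-homo)

    private
      f : Carrier → H.Carrier × ℤ
      f = proj₁ iso

      lift : H.Carrier × ℤ → Carrier
      lift y = proj₁ (surjective y)

      f-lift : ∀ y → AbelianGroup._≈_ (H ⊕ Cyclic e) (f (lift y)) y
      f-lift y = proj₂ (surjective y) ≈-refl

      g : Carrier
      g = lift (H.ε , 1ℤ)

      γ : Fin n
      γ = index g

      InH : Carrier → Set
      InH x = proj₂ (f x) C.≈ 0ℤ

      -- Terms are copies of `g`, with cyclic coordinate 1, or have coordinate 0, so modulo `e` the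
      -- coordinate of the sum counts the copies of `g`.
      proj₂-f-σ : ∀ {T} → All (λ x → γ ≡ index x ⊎ InH x) T → proj₂ (f (σ T)) C.≈ (ℤ.+ count T γ)
      proj₂-f-σ [] = proj₂ ε-homo
      proj₂-f-σ (_∷_ {x} {T} px pxs) = begin
        proj₂ (f (x ∙ σ T))                       ≈⟨ proj₂ (∙-homo x (σ T)) ⟩
        proj₂ (f x) ℤ.+ proj₂ (f (σ T))           ≈⟨ C.∙-cong {proj₂ (f x)} {ℤ.+ indicator (index x) γ} {proj₂ (f (σ T))} {ℤ.+ count T γ}
                                                       (value px) (proj₂-f-σ pxs) ⟩
        ℤ.+ (indicator (index x) γ + count T γ)   ∎
        where
        open SetoidReasoning C.setoid
        value : γ ≡ index x ⊎ InH x → proj₂ (f x) C.≈ (ℤ.+ indicator (index x) γ)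
        value px with index x Fin.≟ γ | px
        ... | yes eq | _        = begin
          proj₂ (f x)   ≈⟨ proj₂ (⟦⟧-cong (index-injective eq)) ⟩
          proj₂ (f g)   ≈⟨ proj₂ (f-lift (H.ε , 1ℤ)) ⟩
          1ℤ            ∎
        ... | no neq | inj₁ eq  = contradiction (sym eq) neq
        ... | no _   | inj₂ inH = inH

      e∣count : ∀ {T} → ZeroSum G T → All (λ x → γ ≡ index x ⊎ InH x) T → e divides count T γ
      e∣count {T} z pxs = subst (e divides_) (cong ℤ.∣_∣ (ℤ.+-identityʳ (ℤ.+ count T γ))) (ℤ.∣⇒∣ᵤ (begin
        ℤ.+ count T γ     ≈⟨ proj₂-f-σ pxs ⟨
        proj₂ (f (σ T))   ≈⟨ proj₂ (⟦⟧-cong z) ⟩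
        proj₂ (f ε)       ≈⟨ proj₂ ε-homo ⟩
        0ℤ                ∎))
        where open SetoidReasoning C.setoid

      -- A block containing `g` contains it at least `e` times, and there are fewer than `e` copies
      -- per block on average.
      free-block : ∀ {Ts} → All (λ T → Block T × e divides count T γ) Ts → count (concat Ts) γ < length Ts * e →
        ∃[ T ] Block T × count T γ ≡ 0 × T ∣ concat Ts
      free-block (_∷_ {T} {Ts} (b , e∣) rest) few with count T γ in eq
      ... | zero  = T , b , eq , concat Ts , ↭-refl
      ... | suc m =
        let U , bU , eqU , z , p = free-block rest (+-cancelˡ-≤ e _ _ (begin
              e + suc (count (concat Ts) γ)           ≡⟨ +-suc e _ ⟩
              suc (e + count (concat Ts) γ)           ≤⟨ s≤s (+-monoˡ-≤ (count (concat Ts) γ) (∣⇒≤ e∣)) ⟩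
              suc (suc m + count (concat Ts) γ)       ≡⟨ cong (λ m → suc (m + count (concat Ts) γ)) eq ⟨
              suc (count T γ + count (concat Ts) γ)   ≡⟨ cong suc (count-++ T (concat Ts) γ) ⟨
              suc (count (T ++ concat Ts) γ)          ≤⟨ few ⟩
              e + length Ts * e                       ∎))
        in U , bU , eqU , T ++ z , ↭-trans (shifts U T) (++⁺ˡ T p)
        where open ≤-Reasoning

      inH-lift : ∀ s → InH (lift (s , 0ℤ))
      inH-lift s = proj₂ (f-lift (s , 0ℤ))

      -- Comparing cyclic coordinates, equality would give 1 ≡ 0 modulo `e`.
      lift≢g : ∀ s → index (lift (s , 0ℤ)) ≢ γ
      lift≢g s eq = <⇒≱ 1<e (∣⇒≤ (ℤ.∣⇒∣ᵤ {ℤ.+ e} {1ℤ} (begin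
        1ℤ                             ≈⟨ proj₂ (f-lift (H.ε , 1ℤ)) ⟨
        proj₂ (f g)                    ≈⟨ proj₂ (⟦⟧-cong (index-injective eq)) ⟨
        proj₂ (f (lift (s , 0ℤ)))      ≈⟨ inH-lift s ⟩
        0ℤ                             ∎)))
        where open SetoidReasoning C.setoid

      embed : List H.Carrier → List Carrier
      embed = map (λ s → lift (s , 0ℤ))

      count-embed : ∀ S → count (embed S) γ ≡ 0
      count-embed []      = refl
      count-embed (s ∷ S) = cong₂ _+_ (indicator-≢ (lift≢g s)) (count-embed S)

      project : List Carrier → List H.Carrier
      project = map (proj₁ ∘ f)

      project-embed : ∀ S → Pointwise H._≈_ (project (embed S)) S
      project-embed []      = []
      project-embed (s ∷ S) = proj₁ (f-lift (s , 0ℤ)) ∷ project-embed S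

      σ-project : ∀ T → foldr H._∙_ H.ε (project T) H.≈ proj₁ (f (σ T))
      σ-project []      = H.sym (proj₁ ε-homo)
      σ-project (x ∷ T) = H.trans (H.∙-congˡ (σ-project T)) (H.sym (proj₁ (∙-homo x (σ T))))

      project-block : ∀ {T} → Block T → NonEmptyZeroSum H (project T)
      project-block {[]}    (ne , _) = contradiction refl ne
      project-block {x ∷ T} (_ , z)  = (λ ()) ,
        H.trans (σ-project (x ∷ T)) (H.trans (proj₁ (⟦⟧-cong z)) (proj₁ ε-homo))

      1≤d⁻ : 1 ≤ d⁻
      1≤d⁻ = IsD-positive H isD

    -- Test sequences: a sequence over H followed by k e − 1 copies of a
    -- generator g of the cyclic summand.  A zero-sum block contains g a
    -- multiple of e times, so one of k disjoint blocks avoids g altogether.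
    d⁻-lower-bound : ∀ {k l} → 1 ≤ k → DProperty k l → d⁻ + k * e ≤ suc l
    -- By minimality of `d⁻` it suffices that l + 1 - k e terms over `H` always contain a block; d⁻
    -- ≥ 1 makes the truncated subtraction harmless.
    d⁻-lower-bound {k} {l} 1≤k D = m≤n∸o⇒m+o≤n d⁻ 1≤d⁻ (proj₂ isD (suc l ∸ k * e) free)
      where
      m≤n∸o⇒m+o≤n : ∀ m {n o} → 1 ≤ m → m ≤ n ∸ o → m + o ≤ n
      m≤n∸o⇒m+o≤n m {n} {o} 1≤m m≤ with o ≤? n
      ... | yes o≤n = ≤-trans (+-monoˡ-≤ o m≤) (≤-reflexive (m∸n+n≡m o≤n))
      ... | no  o≰n = contradiction (≤-trans 1≤m (≤-trans m≤ (≤-reflexive (m≤n⇒m∸n≡0 (<⇒≤ (≰⇒> o≰n)))))) λ ()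
      ke-1 = pred (k * e)
      suc-ke-1 : suc ke-1 ≡ k * e
      suc-ke-1 = suc-pred (k * e) {{>-nonZero (*-mono-≤ 1≤k 1≤e)}}
      free : ∀ S → suc l ∸ k * e ≤ length S → DisjointZeroSums H 1 S
      free S ≤S with D (embed S ++ replicate ke-1 g) (s≤s⁻¹ (begin
          suc l                                   ≤⟨ m≤n+m∸n (suc l) (k * e) ⟩
          k * e + (suc l ∸ k * e)                 ≤⟨ +-monoʳ-≤ (k * e) ≤S ⟩
          k * e + length S                        ≡⟨ cong₂ _+_ suc-ke-1 (List.length-map _ S) ⟨
          suc (ke-1 + length (embed S))           ≡⟨ cong suc (+-comm ke-1 _) ⟩
          suc (length (embed S) + ke-1)           ≡⟨ cong (λ m → suc (length (embed S) + m)) (List.length-replicate ke-1) ⟨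
          suc (length (embed S) + length (replicate ke-1 g)) ≡⟨ cong suc (List.length-++ (embed S)) ⟨
          suc (length (embed S ++ replicate ke-1 g)) ∎))
        where open ≤-Reasoning
      ... | Ts , refl , blocks , z , p
        with free-block (All.zip (blocks , All.zipWith (λ (b , pxs) → e∣count (proj₂ b) pxs) (blocks , coordinates)))
               (subst (count (concat Ts) γ <_) suc-ke-1 (s≤s few))
        where
        P : Carrier → Set
        P x = γ ≡ index x ⊎ InH x
        P-resp : ∀ {x y} → x ≈ y → P x → P y
        P-resp x≈y (inj₁ eq)  = inj₁ (trans eq (index-cong x≈y))
        P-resp {x} {y} x≈y (inj₂ inH) = inj₂ (begin
          proj₂ (f y)   ≈⟨ proj₂ (⟦⟧-cong x≈y) ⟨
          proj₂ (f x)   ≈⟨ inH ⟩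
          0ℤ            ∎)
          where open SetoidReasoning C.setoid
        coordinates : All (All P) Ts
        coordinates = All.concat⁻ (All.++⁻ˡ (concat Ts) (PermutationProperties.All-resp-↭ G-setoid P-resp (↭-sym p)
          (All.++⁺ (All.map⁺ (All.universal (λ s → inj₂ (inH-lift s)) S)) (All.replicate⁺ ke-1 (inj₁ refl)))))
        few : count (concat Ts) γ ≤ ke-1
        few = begin
          count (concat Ts) γ                              ≤⟨ ∣⇒count≤ (z , p) γ ⟩
          count (embed S ++ replicate ke-1 g) γ            ≡⟨ count-++ (embed S) (replicate ke-1 g) γ ⟩
          count (embed S) γ + count (replicate ke-1 g) γ   ≤⟨ +-mono-≤ (≤-reflexive (count-embed S)) (count≤length (replicate ke-1 g) γ) ⟩
          length (replicate ke-1 g)                        ≡⟨ List.length-replicate ke-1 ⟩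
          ke-1                                             ∎
          where open ≤-Reasoning
      ... | T , b , T-free , w , q = project T ∷ [] , refl , project-block b ∷ [] , project (proj₁ T∣S) ,
        H↭.↭-trans (H↭.↭-reflexive (trans (cong (_++ project (proj₁ T∣S)) (List.++-identityʳ (project T)))
            (sym (List.map-++ (proj₁ ∘ f) T (proj₁ T∣S)))))
          (H↭.↭-trans (PermutationProperties.map⁺ G-setoid H.setoid (λ x≈y → proj₁ (⟦⟧-cong x≈y)) (proj₂ T∣S))
            (H↭.↭-reflexive-≋ (project-embed S)))
        where
        -- Free of `g`, the block `T` lies within the embedded `S` and therefore projects to a block
        -- over `H` inside `S`.
        T≤ : ∀ i → count T i ≤ count (embed S) i
        T≤ i with γ Fin.≟ i
        ... | yes refl = ≤-trans (≤-reflexive T-free) z≤n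
        ... | no  γ≢i  = begin
          count T i                                      ≤⟨ ∣⇒count≤ (w , q) i ⟩
          count (concat Ts) i                            ≤⟨ ∣⇒count≤ (z , p) i ⟩
          count (embed S ++ replicate ke-1 g) i          ≡⟨ count-++ (embed S) (replicate ke-1 g) i ⟩
          count (embed S) i + count (replicate ke-1 g) i ≡⟨ cong (count (embed S) i +_) (weight-replicate _ ke-1 g) ⟩
          count (embed S) i + ke-1 * indicator γ i       ≡⟨ cong (λ x → count (embed S) i + ke-1 * x) (indicator-≢ γ≢i) ⟩
          count (embed S) i + ke-1 * 0                   ≡⟨ cong (count (embed S) i +_) (*-zeroʳ ke-1) ⟩
          count (embed S) i + 0                          ≡⟨ +-identityʳ _ ⟩
          count (embed S) i                              ∎
          where open ≤-Reasoning
        T∣S : T ∣ embed S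
        T∣S = count≤⇒∣ T (embed S) T≤

    δ-bound : ∀ δ N η d₀ → IsDelta G δ → HasCardinality (𝒜 G) N → IsEta G e η → IsD₀ G e d₀ →
      d⁻ ≤ η × DFormulaFrom G e d₀ (δ * e * N + η ∸ d⁻)
    δ-bound δ N η d₀ isDelta card isEta isD₀ = d⁻≤η ,
      DFormula-from (1 + δ * N) η d₀ (proj₁ isEta) e≤η (pump-δ δ N isDelta card) (m<n⇒0<n∸m d⁻<) enough long-enough isD₀
      where
      open ≤-Reasoning
      K = δ * e * N + η ∸ d⁻
      D₁ : DProperty 1 η
      D₁ S η≤S = let T , (z , p) , b , _ = proj₁ isEta S η≤S in T ∷ [] , refl , b ∷ [] , z ,
        ↭-trans (↭-reflexive (cong (_++ z) (List.++-identityʳ T))) p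
      -- Every sequence of length η contains a block, so the lower bound applies with k = 1. Since e
      -- ≥ 2, it gives d⁻ < η, which makes `K` positive.
      d⁻+e≤ : d⁻ + e ≤ suc η
      d⁻+e≤ = subst (λ m → d⁻ + m ≤ suc η) (*-identityˡ e) (d⁻-lower-bound ≤-refl D₁)
      d⁻<η : d⁻ < η
      d⁻<η = s≤s⁻¹ (≤-trans (≤-reflexive (trans (cong suc (+-comm 1 d⁻)) (sym (+-suc d⁻ 1)))) (≤-trans (+-monoʳ-≤ d⁻ 1<e) d⁻+e≤))
      d⁻≤η = <⇒≤ d⁻<η
      d⁻< : d⁻ < δ * e * N + η
      d⁻< = ≤-trans d⁻<η (m≤n+m η (δ * e * N))
      e≤η : e ≤ η
      e≤η = s≤s⁻¹ (≤-trans (+-monoˡ-≤ e 1≤d⁻) d⁻+e≤)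
      -- The formula at k₀ turns the lower bound into D(G⁻) ≤ D₀(G) + 1; this is the source of the
      -- term -D(G⁻) in the theorem.
      d⁻≤1+d₀ : d⁻ ≤ suc d₀
      d⁻≤1+d₀ = let k₀ , 1≤k₀ , formula = isD₀ in
        +-cancelʳ-≤ (k₀ * e) d⁻ (suc d₀) (d⁻-lower-bound 1≤k₀ (proj₁ (formula k₀ ≤-refl)))
      K≤k⇒ : ∀ {k} → K ≤ k → δ * e * N + η ≤ k + d⁻
      K≤k⇒ {k} K≤k = begin
        δ * e * N + η     ≡⟨ m∸n+n≡m (<⇒≤ d⁻<) ⟨
        K + d⁻            ≤⟨ +-monoˡ-≤ d⁻ K≤k ⟩
        k + d⁻            ∎
      enough : ∀ k → K ≤ k → 1 + δ * N + η ≤ k + suc d₀ + e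
      enough k K≤k = begin
        1 + δ * N + η           ≤⟨ +-monoˡ-≤ η (+-mono-≤ 1≤e (*-monoˡ-≤ N (m≤m*n δ e {{>-nonZero 1≤e}}))) ⟩
        e + δ * e * N + η       ≡⟨ +-assoc e (δ * e * N) η ⟩
        e + (δ * e * N + η)     ≡⟨ +-comm e _ ⟩
        δ * e * N + η + e       ≤⟨ +-monoˡ-≤ e (≤-trans (K≤k⇒ K≤k) (+-monoʳ-≤ k d⁻≤1+d₀)) ⟩
        k + suc d₀ + e          ∎
      long-enough : ∀ k l → K ≤ k → DProperty k l → η ≤ l + e
      long-enough k l K≤k D = begin
        η                  ≤⟨ m≤n+m η (δ * e * N) ⟩
        δ * e * N + η      ≤⟨ K≤k⇒ K≤k ⟩
        k + d⁻             ≡⟨ +-comm k d⁻ ⟩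
        d⁻ + k             ≤⟨ +-monoʳ-≤ d⁻ (m≤m*n k e {{>-nonZero 1≤e}}) ⟩
        d⁻ + k * e         ≤⟨ d⁻-lower-bound (≤-trans (m<n⇒0<n∸m d⁻<) K≤k) D ⟩
        suc l              ≡⟨ +-comm 1 l ⟩
        l + 1              ≤⟨ +-monoʳ-≤ l 1≤e ⟩
        l + e              ∎

-- The bound in terms of |G|

funToFin-cong : ∀ {m n} {f g : Fin m → Fin n} → (∀ i → f i ≡ g i) → funToFin f ≡ funToFin g
funToFin-cong {zero}  f≗g = refl
funToFin-cong {suc m} f≗g = cong₂ combine (f≗g zero) (funToFin-cong (f≗g ∘ suc))

-- Vectors with `N` entries below `b` are the digits of numbers below b^N.
vector-pigeonhole : ∀ {N b k} → b ^ N < k → (v : Fin k → Fin N → ℕ) → (∀ j g → v j g < b) →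
  ∃[ i ] ∃[ j ] i Fin.< j × (∀ g → v i g ≡ v j g)
vector-pigeonhole {N} {b} {k} few v v<b with Fin.pigeonhole few (λ j → funToFin (λ g → fromℕ< (v<b j g)))
... | i , j , i<j , eq = i , j , i<j , λ g → begin
  v i g                    ≡⟨ decode i g ⟩
  toℕ (finToFun (code i) g) ≡⟨ cong (λ x → toℕ (finToFun {b} x g)) eq ⟩
  toℕ (finToFun (code j) g) ≡⟨ decode j g ⟨
  v j g                    ∎
  where
  open ≡-Reasoning
  code : Fin k → Fin (b ^ N)
  code j = funToFin (λ g → fromℕ< (v<b j g))
  decode : ∀ j g → v j g ≡ toℕ (finToFun (code j) g)
  decode j g = sym (trans (cong toℕ (Fin.finToFun-funToFin (λ g → fromℕ< (v<b j g)) g)) (Fin.toℕ-fromℕ< (v<b j g)))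

-- Inner products, rounding and characteristic vectors.

infix 7 _·_
_·_ : ∀ {s} → (Fin s → ℕ) → (Fin s → ℕ) → ℕ
m · w = sum (λ a → m a * w a)

·-distribʳ-+ : ∀ {s} (w x y : Fin s → ℕ) → (λ a → x a + y a) · w ≡ x · w + y · w
·-distribʳ-+ w x y = trans (sum-cong-≗ λ a → *-distribʳ-+ (w a) (x a) (y a)) (∑-distrib-+ (λ a → x a * w a) (λ a → y a * w a))

·-cong : ∀ {s} (w : Fin s → ℕ) {x y : Fin s → ℕ} → (∀ a → x a ≡ y a) → x · w ≡ y · w
·-cong w x≗y = sum-cong-≗ λ a → cong (_* w a) (x≗y a)

·-∸ : ∀ {s} (w x y : Fin s → ℕ) → (∀ a → y a ≤ x a) → (λ a → x a ∸ y a) · w + y · w ≡ x · w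
·-∸ w x y y≤x = trans (sym (·-distribʳ-+ w (λ a → x a ∸ y a) y)) (·-cong w λ a → m∸n+n≡m (y≤x a))

module _ {s : ℕ} (i : ℕ) .{{_ : NonZero i}} (x : Fin s → ℕ) where

  scale : ℕ → Fin s → ℕ
  scale j a = j * x a / i

  scale-upper : ∀ (w : Fin s → ℕ) j → i * (scale j · w) ≤ j * (x · w)
  scale-upper w j = begin
    i * (scale j · w)                     ≡⟨ *-distribˡ-sum i (λ a → scale j a * w a) ⟩
    sum (λ a → i * (scale j a * w a))     ≤⟨ sum-mono-≤ (λ a → begin
      i * (scale j a * w a)                 ≡⟨ rearrange i (scale j a) (w a) ⟩
      scale j a * i * w a                   ≤⟨ *-monoˡ-≤ (w a) (m/n*n≤m (j * x a) i) ⟩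
      j * x a * w a                         ≡⟨ *-assoc j (x a) (w a) ⟩
      j * (x a * w a)                       ∎) ⟩
    sum (λ a → j * (x a * w a))           ≡⟨ *-distribˡ-sum j (λ a → x a * w a) ⟨
    j * (x · w)                           ∎
    where
    open ≤-Reasoning
    rearrange : ∀ i p w → i * (p * w) ≡ p * i * w
    rearrange = solve-∀

  -- Rounding loses at most 1 in every coordinate, hence at most `sum w` in the inner product. As in
  -- `scale-upper`, multiplication by `i` avoids fractions.
  scale-lower : ∀ (w : Fin s → ℕ) j → j * (x · w) ≤ i * (scale j · w + sum w)
  scale-lower w j = begin
    j * (x · w)                           ≡⟨ *-distribˡ-sum j (λ a → x a * w a) ⟩
    sum (λ a → j * (x a * w a))           ≤⟨ sum-mono-≤ (λ a → begin
      j * (x a * w a)                                   ≡⟨ *-assoc j (x a) (w a) ⟨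
      j * x a * w a                                     ≡⟨ cong (_* w a) (m≡m%n+[m/n]*n (j * x a) i) ⟩
      (j * x a % i + scale j a * i) * w a               ≤⟨ *-monoˡ-≤ (w a) (+-monoˡ-≤ (scale j a * i) (<⇒≤ (m%n<n (j * x a) i))) ⟩
      (i + scale j a * i) * w a                         ≡⟨ rearrange i (scale j a) (w a) ⟩
      i * (scale j a * w a + w a)                       ∎) ⟩
    sum (λ a → i * (scale j a * w a + w a)) ≡⟨ *-distribˡ-sum i (λ a → scale j a * w a + w a) ⟨
    i * sum (λ a → scale j a * w a + w a)   ≡⟨ cong (i *_) (∑-distrib-+ (λ a → scale j a * w a) w) ⟩
    i * (scale j · w + sum w)               ∎
    where
    open ≤-Reasoning
    rearrange : ∀ i p w → (i + p * i) * w ≡ i * (p * w + w)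
    rearrange = solve-∀

  scale-mono : ∀ {j k} → j ≤ k → ∀ a → scale j a ≤ scale k a
  scale-mono j≤k a = /-monoˡ-≤ i (*-monoˡ-≤ (x a) j≤k)

  scale≤ : ∀ {j} → j ≤ i → ∀ a → scale j a ≤ x a
  scale≤ {j} j≤i a = begin
    j * x a / i  ≤⟨ /-monoˡ-≤ i (*-monoˡ-≤ (x a) j≤i) ⟩
    i * x a / i  ≡⟨ cong (_/ i) (*-comm i (x a)) ⟩
    x a * i / i  ≡⟨ m*n/n≡m (x a) i ⟩
    x a          ∎
    where open ≤-Reasoning

-- Characteristic vectors of the subsets of `Fin s`, numbered by their binary digits.
bits : ∀ {s} → Fin (2 ^ s) → Fin s → ℕ
bits i a = toℕ (finToFun i a)

bits≤1 : ∀ {s} (i : Fin (2 ^ s)) a → bits {s} i a ≤ 1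
bits≤1 i a = s≤s⁻¹ (Fin.toℕ<n (finToFun i a))

bits-differ : ∀ {s} {i j : Fin (2 ^ s)} → i ≢ j →
  (∃[ a ] bits {s} i a ≡ 1 × bits {s} j a ≡ 0) ⊎ (∃[ a ] bits {s} j a ≡ 1 × bits {s} i a ≡ 0)
bits-differ {s} {i} {j} i≢j
  with Fin.any? (λ a → bits {s} i a ≟ 1 ×-dec bits {s} j a ≟ 0) | Fin.any? (λ a → bits {s} j a ≟ 1 ×-dec bits {s} i a ≟ 0)
... | yes found | _         = inj₁ found
... | no  _     | yes found = inj₂ found
... | no  none₁ | no  none₂ = contradiction (begin
  i                             ≡⟨ Fin.funToFin-finToFin {s} i ⟨
  funToFin (finToFun {2} {s} i) ≡⟨ funToFin-cong (λ a → agree (finToFun i a) (finToFun j a) (none₁ ∘ (a ,_)) (none₂ ∘ (a ,_))) ⟩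
  funToFin (finToFun {2} {s} j) ≡⟨ Fin.funToFin-finToFin {s} j ⟩
  j                             ∎) i≢j
  where
  open ≡-Reasoning
  agree : (p q : Fin 2) → ¬ (toℕ p ≡ 1 × toℕ q ≡ 0) → ¬ (toℕ q ≡ 1 × toℕ p ≡ 0) → p ≡ q
  agree zero       zero       _ _ = refl
  agree (suc zero) (suc zero) _ _ = refl
  agree zero       (suc zero) _ h = contradiction (refl , refl) h
  agree (suc zero) zero       h _ = contradiction (refl , refl) h

1+n∸d≤n : ∀ {d n} → 1 ≤ d → suc n ∸ d ≤ n
1+n∸d≤n {suc d} {n} _ = m∸n≤m n d

-- If p₁ - q₁ = p₂ - q₂, then p₂ - p₁ = q₂ - q₁; the shift by `c` keeps the differences natural.
equal-increments : ∀ c v v′ p₁ p₂ q₁ q₂ → v + p₁ ≡ p₂ → v′ + q₁ ≡ q₂ → q₁ ≤ p₁ + c → q₂ ≤ p₂ + c →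
  p₁ + c ∸ q₁ ≡ p₂ + c ∸ q₂ → v ≡ v′
equal-increments c v v′ p₁ _ q₁ _ refl refl q₁≤ q₂≤ eq = +-cancelʳ-≡ (p₁ + c) v v′ (begin
  v + (p₁ + c)                          ≡⟨ +-assoc v p₁ c ⟨
  v + p₁ + c                            ≡⟨ m∸n+n≡m q₂≤ ⟨
  (v + p₁ + c ∸ (v′ + q₁)) + (v′ + q₁)  ≡⟨ cong (_+ (v′ + q₁)) eq ⟨
  (p₁ + c ∸ q₁) + (v′ + q₁)             ≡⟨ rearrange (p₁ + c ∸ q₁) v′ q₁ ⟩
  v′ + (p₁ + c ∸ q₁ + q₁)               ≡⟨ cong (v′ +_) (m∸n+n≡m q₁≤) ⟩
  v′ + (p₁ + c)                         ∎)
  where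
  open ≡-Reasoning
  rearrange : ∀ a b c → a + (b + c) ≡ b + (a + c)
  rearrange = solve-∀

-- Blocks with bounded multiplicities and their combinations.

module Compression {c ℓ} (G : AbelianGroup c ℓ) (n : ℕ) (order : HasOrder G n)
    (e : ℕ) (exponent : IsExponent G e) where
  1≤e : 1 ≤ e
  1≤e = proj₁ (proj₁ exponent)

  open ZeroSums G n order
  open Descent e 1≤e

  1≤n : 1 ≤ n
  1≤n = positive n (index ε)
    where
    positive : ∀ n → Fin n → 1 ≤ n
    positive (suc n) _ = s≤s z≤n

  -- Translation by x permutes G, so Σ g = Σ (x + g) = n x + Σ g.
  order-annihilates : ∀ x → multiple rawMonoid n x ≈ ε
  order-annihilates x = identityˡ-unique (multiple rawMonoid n x) (sum-G element) (begin
    multiple rawMonoid n x ∙ sum-G element               ≈⟨ ∙-congʳ (sum-replicate n) ⟨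
    sum-G {n} (λ _ → x) ∙ sum-G element                  ≈⟨ ∑-distrib (λ _ → x) element ⟨
    sum-G (λ i → x ∙ element i)                          ≈⟨ sum-cong-≋ (λ i → ≈-sym (element-index (x ∙ element i))) ⟩
    sum-G (λ i → element (index (x ∙ element i)))        ≈⟨ sum-permute element translation ⟨
    sum-G element                                        ∎)
    where
    open AbelianGroup G using (group; commutativeMonoid)
    open GroupProperties group using (identityˡ-unique; \\-leftDividesˡ; \\-leftDividesʳ)
    open CommutativeMonoidSum commutativeMonoid using (sum-replicate; sum-cong-≋; sum-permute) renaming (sum to sum-G; ∑-distrib-+ to ∑-distrib)
    open SetoidReasoning G-setoid
    element-index : ∀ y → element (index y) ≈ y
    element-index y = index-injective (index-element (index y))
    translation : Fin.Permutation n n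
    translation = Fin.permutation (λ i → index (x ∙ element i)) (λ i → index (x ⁻¹ ∙ element i))
      (λ i → trans (index-cong (≈-trans (∙-congˡ (element-index _)) (\\-leftDividesˡ x _))) (index-element i))
      (λ i → trans (index-cong (≈-trans (∙-congˡ (element-index _)) (\\-leftDividesʳ x _))) (index-element i))

  e≤n : e ≤ n
  e≤n = proj₂ exponent n (1≤n , order-annihilates)

  power-block : ∀ x → Block (replicate e x)
  power-block x = nonempty e 1≤e , ≈-trans (σ-replicate e) (proj₂ (proj₁ exponent) x)
    where
    nonempty : ∀ m → 1 ≤ m → replicate m x ≢ []
    nonempty (suc m) _ ()
    σ-replicate : ∀ m → σ (replicate m x) ≈ multiple rawMonoid m x
    σ-replicate zero    = ≈-refl
    σ-replicate (suc m) = ∙-congˡ (σ-replicate m)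

  power-∣ : ∀ {m i} T → m ≤ count T i → replicate m (element i) ∣ T
  power-∣ {m} {i} T m≤ = count≤⇒∣ (replicate m (element i)) T λ j → ≤-trans
    (≤-reflexive (trans (weight-replicate _ m (element i)) (cong (λ k → m * indicator k j) (index-element i))))
    (bound j)
    where
    bound : ∀ j → m * indicator i j ≤ count T j
    bound j with i Fin.≟ j
    ... | yes refl = ≤-trans (≤-reflexive (*-identityʳ m)) m≤
    ... | no  _    = ≤-trans (≤-reflexive (*-zeroʳ m)) z≤n

  -- Some element occurs `e` times among n e terms, and `e` copies of it form a block. The crude
  -- value n e takes the place of η(G) in the second bound.
  η-n*e : EtaProperty (n * e)
  η-n*e S ne≤ = let i , e≤ = frequent S e (*-mono-≤ 1≤n 1≤e) ne≤ in
    replicate e (element i) , power-∣ S e≤ , power-block (element i) , ≤-reflexive (List.length-replicate e)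

  -- With more than `e` copies of an element, `e` of them could be split off and would leave a
  -- second block; and e ≤ n.
  indecomposable⇒count≤n : ∀ {T} → Block T → AtMost 1 T → ∀ i → count T i ≤ n
  indecomposable⇒count≤n {T} b most i = ≤-trans (≮⇒≥ λ e<count → impossible e<count (power-∣ T (<⇒≤ e<count))) e≤n
    where
    impossible : e < count T i → ¬ replicate e (element i) ∣ T
    impossible e<count ([] , p) = <⇒≱ e<count (begin
      count T i                                ≤⟨ count≤length T i ⟩
      length T                                 ≡⟨ length-++-↭ (replicate e (element i)) [] p ⟨
      length (replicate e (element i)) + 0     ≡⟨ +-identityʳ _ ⟩
      length (replicate e (element i))         ≡⟨ List.length-replicate e ⟩
      e                                        ∎)
      where open ≤-Reasoning
    impossible _ (x ∷ z , p) = contradiction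
      (most 2 (splits-resp-↭ p (splits-++ (splits-block pb) (splits-block
        ((λ ()) , cofactor-zeroSum (replicate e (element i)) (x ∷ z) (proj₂ pb) (proj₂ b) p)))))
      λ { (s≤s ()) }
      where pb = power-block (element i)

  -- The bound on multiplicities keeps the columns small in the pigeonhole arguments; blocks of
  -- optimal partitions satisfy it by `indecomposable⇒count≤n`.
  IsFamily : ∀ {s} → (Fin s → List Carrier) → Set (c L.⊔ ℓ)
  IsFamily A = ∀ a → Block (A a) × (∀ g → count (A a) g ≤ n)

  comb : ∀ {s} → (Fin s → ℕ) → (Fin s → List Carrier) → List Carrier
  comb m A = concat (copies m A)

  column : ∀ {s} → (Fin s → List Carrier) → Fin n → Fin s → ℕ
  column A g a = count (A a) g

  count-comb : ∀ {s} (m : Fin s → ℕ) A g → count (comb m A) g ≡ m · column A g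
  count-comb m A g = trans (weight-concat _ (copies m A)) (weight-copies (λ T → count T g) m A)

  splits-comb : ∀ {s} (m : Fin s → ℕ) {A} → IsFamily A → Splits (sum m) (comb m A)
  splits-comb m {A} fam = copies m A , length-copies m A , All-copies (proj₁ ∘ fam) , ↭-refl

  comb-↭ : ∀ {s t} (m : Fin s → ℕ) A (m′ : Fin t → ℕ) A′ →
    (∀ g → m · column A g ≡ m′ · column A′ g) → comb m A ↭ comb m′ A′
  comb-↭ m A m′ A′ eq = count-≗⇒↭ (comb m A) (comb m′ A′) λ g →
    trans (count-comb m A g) (trans (eq g) (sym (count-comb m′ A′ g)))

  comb-∸-↭ : ∀ {s} (m y : Fin s → ℕ) A → (∀ a → y a ≤ m a) → comb (λ a → m a ∸ y a) A ++ comb y A ↭ comb m A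
  comb-∸-↭ m y A y≤m = count-≗⇒↭ (comb m∸y A ++ comb y A) (comb m A) λ g → begin
    count (comb m∸y A ++ comb y A) g            ≡⟨ count-++ (comb m∸y A) (comb y A) g ⟩
    count (comb m∸y A) g + count (comb y A) g   ≡⟨ cong₂ _+_ (count-comb m∸y A g) (count-comb y A g) ⟩
    m∸y · column A g + y · column A g           ≡⟨ ·-∸ (column A g) m y y≤m ⟩
    m · column A g                              ≡⟨ count-comb m A g ⟨
    count (comb m A) g                          ∎
    where
    open ≡-Reasoning
    m∸y = λ a → m a ∸ y a

  atMost-comb : ∀ {s} (m y : Fin s → ℕ) {A} → IsFamily A → (∀ a → y a ≤ m a) →
    AtMost (sum m) (comb m A) → AtMost (sum y) (comb y A)
  atMost-comb m y {A} fam y≤m most = atMost-cofactor (splits-comb (λ a → m a ∸ y a) fam) (comb-∸-↭ m y A y≤m)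
    (subst (λ k → AtMost k (comb m A)) (sym (sum-∸ m y y≤m)) most)

  sum-column≤ : ∀ {s} {A : Fin s → List Carrier} → IsFamily A → ∀ g → sum (column A g) ≤ s * n
  sum-column≤ fam g = sum-bound (λ a → proj₂ (fam a) g)

  module _ {s : ℕ} where

    trade : ∀ A {x y m : Fin s → ℕ} →
      (∀ a → x a ≤ m a) → (∀ g → x · column A g ≡ y · column A g) →
      comb (λ a → m a ∸ x a + y a) A ↭ comb m A
    trade A {x} {y} {m} x≤m eq = comb-↭ (λ a → m a ∸ x a + y a) A m A λ g → begin
      (λ a → m a ∸ x a + y a) · column A g               ≡⟨ ·-distribʳ-+ (column A g) (λ a → m a ∸ x a) y ⟩
      (λ a → m a ∸ x a) · column A g + y · column A g    ≡⟨ cong (((λ a → m a ∸ x a) · column A g) +_) (eq g) ⟨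
      (λ a → m a ∸ x a) · column A g + x · column A g    ≡⟨ ·-∸ (column A g) m x x≤m ⟩
      m · column A g                                     ∎
      where open ≡-Reasoning

    trade-sum : ∀ {x y m : Fin s → ℕ} → (∀ a → x a ≤ m a) → sum (λ a → m a ∸ x a + y a) + sum x ≡ sum m + sum y
    trade-sum {x} {y} {m} x≤m = begin
      sum (λ a → m a ∸ x a + y a) + sum x         ≡⟨ cong (_+ sum x) (∑-distrib-+ (λ a → m a ∸ x a) y) ⟩
      sum (λ a → m a ∸ x a) + sum y + sum x       ≡⟨ rearrange (sum (λ a → m a ∸ x a)) (sum y) (sum x) ⟩
      sum (λ a → m a ∸ x a) + sum x + sum y       ≡⟨ cong (_+ sum y) (sum-∸ m x x≤m) ⟩
      sum m + sum y                               ∎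
      where
      open ≡-Reasoning
      rearrange : ∀ a b c → a + b + c ≡ a + c + b
      rearrange = solve-∀

    -- Trading `x` for `y` gives another partition of the same sequence, which by optimality of `m`
    -- has no more blocks.
    trade-≤ : ∀ {A : Fin s → List Carrier} → IsFamily A → ∀ {x y m : Fin s → ℕ} →
      (∀ a → x a ≤ m a) → (∀ g → x · column A g ≡ y · column A g) → AtMost (sum m) (comb m A) → sum y ≤ sum x
    trade-≤ {A} fam {x} {y} {m} x≤m eq most = +-cancelˡ-≤ (sum m) (sum y) (sum x) (begin
      sum m + sum y                           ≡⟨ trade-sum x≤m ⟨
      sum (λ a → m a ∸ x a + y a) + sum x     ≤⟨ +-monoˡ-≤ (sum x)
        (most _ (splits-resp-↭ (trade A x≤m eq) (splits-comb (λ a → m a ∸ x a + y a) fam))) ⟩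
      sum m + sum x                           ∎)
      where open ≤-Reasoning

    -- Splitting a relation between two partitions by rounding.

    module _ {A A′ : Fin s → List Carrier} (fam : IsFamily A) (fam′ : IsFamily A′) (b : Fin s)
             (m x′ : Fin s → ℕ) (many : suc (s * n + s * n) ^ n ≤ m b)
             (most : AtMost (sum m) (comb m A)) where
      private
        x : Fin s → ℕ
        x a = m a + indicator b a

        xb≡ : x b ≡ suc (m b)
        xb≡ = trans (cong (m b +_) (indicator-≡ {i = b} refl)) (+-comm (m b) 1)

        i : ℕ
        i = suc (m b)

        p q : ℕ → Fin s → ℕ
        p = scale i x
        q = scale i x′

        -- The denominator `i` is the multiplicity of `b` in `x`, so rounding is exact at `b`, and
        -- each step from j to j + 1 moves exactly one copy of it.
        pb≡ : ∀ j → p j b ≡ j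
        pb≡ j = trans (cong (λ y → j * y / i) xb≡) (m*n/n≡m j i)

        -- Both sums are (j / i) (y · column B g) up to the rounding errors.
        close : ∀ {B B′ : Fin s → List Carrier} (y y′ : Fin s → ℕ) → IsFamily B →
          (∀ g → y · column B g ≡ y′ · column B′ g) →
          ∀ j g → scale i y′ j · column B′ g ≤ scale i y j · column B g + s * n
        close {B} {B′} y y′ famB eq j g = *-cancelˡ-≤ i (begin
          i * (scale i y′ j · column B′ g)                       ≤⟨ scale-upper i y′ (column B′ g) j ⟩
          j * (y′ · column B′ g)                                 ≡⟨ cong (j *_) (eq g) ⟨
          j * (y · column B g)                                   ≤⟨ scale-lower i y (column B g) j ⟩
          i * (scale i y j · column B g + sum (column B g))      ≤⟨ *-monoʳ-≤ i (+-monoʳ-≤ (scale i y j · column B g) (sum-column≤ famB g)) ⟩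
          i * (scale i y j · column B g + s * n)                 ∎)
          where open ≤-Reasoning

        -- The discrepancy of the two rounded sums, shifted by s n to be natural. Before rounding
        -- there is none, so each entry takes at most 2 s n + 1 values.
        value : Fin i → Fin n → ℕ
        value j g = p (toℕ j) · column A g + s * n ∸ q (toℕ j) · column A′ g

        value≤ : (∀ g → x · column A g ≡ x′ · column A′ g) → ∀ j g → value j g ≤ s * n + s * n
        value≤ eq j g = begin
          p (toℕ j) · column A g + s * n ∸ q (toℕ j) · column A′ g
            ≤⟨ ∸-monoˡ-≤ (q (toℕ j) · column A′ g) (+-monoˡ-≤ (s * n) (close {A′} {A} x′ x fam′ (λ g → sym (eq g)) (toℕ j) g)) ⟩
          q (toℕ j) · column A′ g + s * n + s * n ∸ q (toℕ j) · column A′ g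
            ≡⟨ cong (_∸ q (toℕ j) · column A′ g) (+-assoc (q (toℕ j) · column A′ g) (s * n) (s * n)) ⟩
          q (toℕ j) · column A′ g + (s * n + s * n) ∸ q (toℕ j) · column A′ g
            ≡⟨ m+n∸m≡n (q (toℕ j) · column A′ g) (s * n + s * n) ⟩
          s * n + s * n ∎
          where open ≤-Reasoning

      -- Between two equal discrepancies the increments `y` of `p` and `y′` of `q` have equal sums,
      -- and so have the remainders `z` and `z′`. Both `y` and `z` stay below `m`, whose optimality
      -- then bounds `y′` and `z′`.
      sum≤-of-collision : (∀ g → x · column A g ≡ x′ · column A′ g) →
        ∃[ j₁ ] ∃[ j₂ ] j₁ Fin.< j₂ × (∀ g → value j₁ g ≡ value j₂ g) → sum x′ ≤ sum x
      sum≤-of-collision eq (j₁ , j₂ , j₁<j₂ , same) = begin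
        sum x′           ≡⟨ sum-∸ x′ y′ y′≤x′ ⟨
        sum z′ + sum y′  ≤⟨ +-mono-≤ (part z z′ (λ a → z≤m a (b Fin.≟ a)) z-eq) (part y y′ (λ a → y≤m a (b Fin.≟ a)) y-eq) ⟩
        sum z + sum y    ≡⟨ sum-∸ x y y≤x ⟩
        sum x            ∎
        where
        open ≤-Reasoning
        k₁ = toℕ j₁
        k₂ = toℕ j₂
        k₂≤mb : k₂ ≤ m b
        k₂≤mb = s≤s⁻¹ (Fin.toℕ<n j₂)
        k₂≤i : k₂ ≤ i
        k₂≤i = m≤n⇒m≤1+n k₂≤mb
        y y′ z z′ : Fin s → ℕ
        y  a = p k₂ a ∸ p k₁ a
        y′ a = q k₂ a ∸ q k₁ a
        z  a = x a ∸ y a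
        z′ a = x′ a ∸ y′ a
        y≤x : ∀ a → y a ≤ x a
        y≤x a = ≤-trans (m∸n≤m (p k₂ a) (p k₁ a)) (scale≤ i x k₂≤i a)
        y′≤x′ : ∀ a → y′ a ≤ x′ a
        y′≤x′ a = ≤-trans (m∸n≤m (q k₂ a) (q k₁ a)) (scale≤ i x′ k₂≤i a)
        x≡m : ∀ {a} → b ≢ a → x a ≡ m a
        x≡m {a} b≢a = trans (cong (m a +_) (indicator-≢ b≢a)) (+-identityʳ (m a))
        yb≡ : y b ≡ k₂ ∸ k₁
        yb≡ = cong₂ _∸_ (pb≡ k₂) (pb≡ k₁)
        y≤m : ∀ a → Dec (b ≡ a) → y a ≤ m a
        -- Only at `b` does `x` exceed `m`, and there the increment is k₂ - k₁ ≤ m b.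
        y≤m a (yes refl) = ≤-trans (≤-reflexive yb≡) (≤-trans (m∸n≤m k₂ k₁) k₂≤mb)
        y≤m a (no  b≢a)  = subst (y a ≤_) (x≡m b≢a) (y≤x a)
        z≤m : ∀ a → Dec (b ≡ a) → z a ≤ m a
        -- As k₁ < k₂, at least one of the m b + 1 copies of `b` has gone into `y`.
        z≤m a (yes refl) = ≤-trans (≤-reflexive (cong₂ _∸_ xb≡ yb≡)) (1+n∸d≤n (m<n⇒0<n∸m j₁<j₂))
        z≤m a (no  b≢a)  = ≤-trans (m∸n≤m (x a) (y a)) (≤-reflexive (x≡m b≢a))
        y-eq : ∀ g → y · column A g ≡ y′ · column A′ g
        y-eq g = equal-increments (s * n) (y · column A g) (y′ · column A′ g) (p k₁ · column A g) (p k₂ · column A g)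
            (q k₁ · column A′ g) (q k₂ · column A′ g)
            (·-∸ (column A g) (p k₂) (p k₁) (scale-mono i x (<⇒≤ j₁<j₂)))
            (·-∸ (column A′ g) (q k₂) (q k₁) (scale-mono i x′ (<⇒≤ j₁<j₂)))
            (close {A} {A′} x x′ fam eq k₁ g) (close {A} {A′} x x′ fam eq k₂ g) (same g)
        z-eq : ∀ g → z · column A g ≡ z′ · column A′ g
        z-eq g = +-cancelʳ-≡ (y · column A g) _ _ (trans (·-∸ (column A g) x y y≤x)
          (trans (eq g) (trans (sym (·-∸ (column A′ g) x′ y′ y′≤x′)) (cong (z′ · column A′ g +_) (sym (y-eq g))))))
        part : ∀ w w′ → (∀ a → w a ≤ m a) → (∀ g → w · column A g ≡ w′ · column A′ g) → sum w′ ≤ sum w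
        part w w′ w≤m w-eq = atMost-comb m w fam w≤m most (sum w′)
          (splits-resp-↭ (comb-↭ w′ A′ w A (λ g → sym (w-eq g))) (splits-comb w′ fam′))

      sum≤-of-≗ : (∀ g → x · column A g ≡ x′ · column A′ g) → sum x′ ≤ sum x
      sum≤-of-≗ eq = sum≤-of-collision eq
        (vector-pigeonhole {n} {suc (s * n + s * n)} {i} (s≤s many) value (λ j g → s≤s (value≤ eq j g)))

    -- Multiplicities weighted with `long` vanish on short blocks, so the index found by the
    -- pigeonhole principle belongs to a long one.
    frequent-long-block : ∀ {Q} → 1 ≤ s * Q → (A : Fin s → List Carrier) (m : Fin s → ℕ) → s * Q ≤ longs (copies m A) →
      1 ≤ Q → ∃[ b ] e ≤ length (A b) × Q ≤ m b
    frequent-long-block {Q} 1≤sQ A m sQ≤ 1≤Q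
      with sum-pigeonhole (λ a → m a * long (A a)) Q 1≤sQ (subst (s * Q ≤_) (weight-copies long m A) sQ≤)
    ... | b , Q≤ with e ≤? length (A b)
    ...   | yes e≤ = b , e≤ , subst (Q ≤_) (trans (cong (m b *_) (long-≥ {A b} e≤)) (*-identityʳ (m b))) Q≤
    ...   | no  e≰ = contradiction
      (≤-trans 1≤Q (subst (Q ≤_) (trans (cong (m b *_) (long-< {A b} e≰)) (*-zeroʳ (m b))) Q≤)) λ ()

  -- Exchange of blocks, and compression to a family of `s` blocks.

  module _ (s : ℕ) (subsets : suc (s * n) ^ n < 2 ^ s) where

    -- There are 2^s subsets but at most (s n + 1)^n sums, so two subsets have equal sums; they are
    -- ordered so that `x` has a member outside `y`.
    exchange : ∀ {A : Fin s → List Carrier} → IsFamily A → ∃[ x ] ∃[ y ]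
      (∀ a → x a ≤ 1) × (∀ a → y a ≤ 1) × (∃[ a ] x a ≡ 1 × y a ≡ 0) × (∀ g → x · column A g ≡ y · column A g)
    exchange {A} fam with vector-pigeonhole subsets (λ i g → bits {s} i · column A g) (λ i g → s≤s (begin
        bits {s} i · column A g      ≤⟨ sum-mono-≤ (λ a → *-monoˡ-≤ (column A g a) (bits≤1 {s} i a)) ⟩
        (λ _ → 1) · column A g   ≡⟨ sum-cong-≗ (λ a → *-identityˡ (column A g a)) ⟩
        sum (column A g)         ≤⟨ sum-column≤ fam g ⟩
        s * n                    ∎))
      where open ≤-Reasoning
    ... | i , j , i<j , eq with bits-differ {s} (Fin.<⇒≢ i<j)
    ...   | inj₁ found = bits {s} i , bits {s} j , bits≤1 {s} i , bits≤1 {s} j , found , eq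
    ...   | inj₂ found = bits {s} j , bits {s} i , bits≤1 {s} j , bits≤1 {s} i , found , λ g → sym (eq g)

    -- Trading x for y keeps the sum and, by optimality, the number of blocks,
    -- while the multiplicity of b decreases.
    vacate : ∀ {A : Fin s → List Carrier} → IsFamily A → ∀ m → AtMost (sum m) (comb m A) →
      ∃[ m′ ] comb m′ A ↭ comb m A × sum m′ ≡ sum m × (∃[ a ] m′ a ≡ 0)
    vacate {A} fam m most with exchange fam
    ... | x , y , x≤1 , y≤1 , (b , xb≡1 , yb≡0) , eq = loop (m b) m refl most
      where
      loop : ∀ t m → m b ≡ t → AtMost (sum m) (comb m A) →
        ∃[ m′ ] comb m′ A ↭ comb m A × sum m′ ≡ sum m × (∃[ a ] m′ a ≡ 0)
      loop t m mb≡t most with Fin.any? (λ a → m a ≟ 0)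
      ... | yes found = m , ↭-refl , refl , found
      loop zero    m mb≡t most | no none = contradiction (b , mb≡t) none
      loop (suc t) m mb≡t most | no none =
        let m″ , p , eq″ , found = loop t m′ m′b≡t (subst (λ k → AtMost k (comb m′ A)) (sym sum-m′) (atMost-resp-↭ (↭-sym m′↭m) most))
        in m″ , ↭-trans p m′↭m , trans eq″ sum-m′ , found
        where
        1≤m : ∀ a → 1 ≤ m a
        1≤m a = n≢0⇒n>0 (none ∘ (a ,_))
        m′ : Fin s → ℕ
        m′ a = m a ∸ x a + y a
        x≤m : ∀ a → x a ≤ m a
        x≤m a = ≤-trans (x≤1 a) (1≤m a)
        m′↭m : comb m′ A ↭ comb m A
        m′↭m = trade A x≤m eq
        -- All multiplicities are positive here, so `x` and `y` both lie below `m` and the trade is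
        -- possible in either direction.
        sum-x≡y : sum x ≡ sum y
        sum-x≡y = ≤-antisym (trade-≤ fam (λ a → ≤-trans (y≤1 a) (1≤m a)) (λ g → sym (eq g)) most) (trade-≤ fam x≤m eq most)
        sum-m′ : sum m′ ≡ sum m
        sum-m′ = +-cancelʳ-≡ (sum x) (sum m′) (sum m) (trans (trade-sum x≤m) (cong (sum m +_) (sym sum-x≡y)))
        m′b≡t : m′ b ≡ t
        m′b≡t = begin
          m b ∸ x b + y b   ≡⟨ cong₂ (λ i j → m b ∸ i + j) xb≡1 yb≡0 ⟩
          m b ∸ 1 + 0       ≡⟨ +-identityʳ (m b ∸ 1) ⟩
          m b ∸ 1           ≡⟨ cong (_∸ 1) mb≡t ⟩
          t                 ∎
          where open ≡-Reasoning

    -- Induction on the partition: the new block takes the slot of multiplicity 0, and `vacate` then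
    -- clears a slot again. The vacant slot is therefore part of the claim.
    compress : ∀ {Ts} → Fin s → All Block Ts → AtMost (length Ts) (concat Ts) →
      ∃[ A ] ∃[ m ] IsFamily {s} A × comb m A ↭ concat Ts × sum m ≡ length Ts × (∃[ a ] m a ≡ 0)
    -- With nothing to place, every slot holds the one-term block 0, taken zero times.
    compress {[]} a [] most = (λ _ → ε ∷ []) , (λ _ → 0) ,
      (λ _ → ((λ ()) , identityˡ ε) , λ g → ≤-trans (count≤length (ε ∷ []) g) 1≤n) ,
      count-≗⇒↭ _ [] (λ g → trans (count-comb {s} (λ _ → 0) (λ _ → ε ∷ []) g) (sum-replicate-zero s)) , sum-replicate-zero s , a , refl
    compress {T ∷ Ts} a₀ (b ∷ blocks) most
      with compress a₀ blocks (atMost-cofactor (splits-block b) ↭-refl most)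
    ... | A , m , fam , p , sum-m , v , mv≡0 =
      let m″ , q , eq , vacant = vacate fam′ m′ (subst (λ k → AtMost k (comb m′ A′)) (sym sum-m′) (atMost-resp-↭ (↭-sym p′) most))
      in A′ , m″ , fam′ , ↭-trans q p′ , trans eq sum-m′ , vacant
      where
      A′ : Fin s → List Carrier
      A′ = updateAt A v (const T)
      m′ : Fin s → ℕ
      m′ a = m a + indicator v a
      fam′ : IsFamily A′
      fam′ a with a Fin.≟ v
      ... | yes refl = subst (λ U → Block U × (∀ g → count U g ≤ n)) (sym (updateAt-updates v A))
        (b , indecomposable⇒count≤n b (All.head (atMost⇒indecomposable (b ∷ blocks) most)))
      ... | no  a≢v  = subst (λ U → Block U × (∀ g → count U g ≤ n)) (sym (updateAt-minimal a v A a≢v)) (fam a)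
      pointwise : ∀ g a → m′ a * column A′ g a ≡ m a * column A g a + count T g * indicator a v
      pointwise g a with a Fin.≟ v
      ... | yes refl = begin
        (m a + indicator a a) * count (A′ a) g    ≡⟨ cong₂ (λ i U → (m a + i) * count U g) (indicator-≡ {i = a} refl) (updateAt-updates a A) ⟩
        (m a + 1) * count T g                     ≡⟨ cong (λ i → (i + 1) * count T g) mv≡0 ⟩
        1 * count T g                             ≡⟨ *-comm 1 (count T g) ⟩
        count T g * 1                             ≡⟨ cong (λ i → i * count (A a) g + count T g * 1) mv≡0 ⟨
        m a * count (A a) g + count T g * 1       ∎
        where open ≡-Reasoning
      ... | no  a≢v  = begin
        (m a + indicator v a) * count (A′ a) g    ≡⟨ cong₂ (λ i U → (m a + i) * count U g) (indicator-≢ (a≢v ∘ sym)) (updateAt-minimal a v A a≢v) ⟩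
        (m a + 0) * count (A a) g                 ≡⟨ rearrange (m a) (count (A a) g) (count T g) ⟩
        m a * count (A a) g + count T g * 0       ∎
        where
        open ≡-Reasoning
        rearrange : ∀ m u t → (m + 0) * u ≡ m * u + t * 0
        rearrange = solve-∀
      p′ : comb m′ A′ ↭ T ++ concat Ts
      p′ = ↭-trans (count-≗⇒↭ (comb m′ A′) (T ++ comb m A) λ g → begin
        count (comb m′ A′) g                                            ≡⟨ count-comb m′ A′ g ⟩
        m′ · column A′ g                                                ≡⟨ sum-cong-≗ (pointwise g) ⟩
        sum (λ a → m a * column A g a + count T g * indicator a v)      ≡⟨ ∑-distrib-+ (λ a → m a * column A g a) _ ⟩
        m · column A g + sum (λ a → count T g * indicator a v)          ≡⟨ cong₂ _+_ (sym (count-comb m A g)) (sum-indicatorˡ (λ _ → count T g) v) ⟩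
        count (comb m A) g + count T g                                  ≡⟨ +-comm (count (comb m A) g) (count T g) ⟩
        count T g + count (comb m A) g                                  ≡⟨ count-++ T (comb m A) g ⟨
        count (T ++ comb m A) g                                         ∎) (++⁺ˡ T p)
        where open ≡-Reasoning
      sum-m′ : sum m′ ≡ suc (length Ts)
      sum-m′ = trans (∑-distrib-+ m (indicator v)) (trans (cong₂ _+_ sum-m (sum-indicator v)) (+-comm (length Ts) 1))

    pump-rounding : 1 ≤ s → Pump (s * suc (s * n + s * n) ^ n)
    pump-rounding 1≤s B _ zB (Ts , refl , blocks , p) most enough none
      with compress (fromℕ< 1≤s) blocks (atMost-resp-↭ (↭-sym p) most)
    ... | A , m , fam , q , sum-m , _
      -- At most `s` different blocks share the long ones, so one of these has the multiplicity that
      -- the rounding argument demands.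
      with frequent-long-block (*-mono-≤ 1≤s (m^n>0 (suc (s * n + s * n)) n)) A m
             (enough (copies m A) (All-copies (proj₁ ∘ fam)) (↭-trans q p) (trans (length-copies m A) sum-m))
             (m^n>0 (suc (s * n + s * n)) n)
    ... | b , e≤U , many = none (A b , proj₁ (fam b) , e≤U , bound)
      where
      m⁺ : Fin s → ℕ
      m⁺ a = m a + indicator b a
      comb-m⁺ : ∀ g → m⁺ · column A g ≡ count (A b ++ B) g
      comb-m⁺ g = begin
        m⁺ · column A g                                              ≡⟨ ·-distribʳ-+ (column A g) m (indicator b) ⟩
        m · column A g + sum (λ a → indicator b a * column A g a)    ≡⟨ cong (m · column A g +_) (sum-cong-≗ λ a →
                                                                          trans (*-comm (indicator b a) (column A g a)) (cong (column A g a *_) (indicator-sym b a))) ⟩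
        m · column A g + sum (λ a → column A g a * indicator a b)    ≡⟨ cong₂ _+_ (sym (count-comb m A g)) (sum-indicatorˡ (column A g) b) ⟩
        count (comb m A) g + count (A b) g                           ≡⟨ cong (_+ count (A b) g) (count-resp-↭ (↭-trans q p) g) ⟩
        count B g + count (A b) g                                    ≡⟨ +-comm (count B g) (count (A b) g) ⟩
        count (A b) g + count B g                                    ≡⟨ count-++ (A b) B g ⟨
        count (A b ++ B) g                                           ∎
        where open ≡-Reasoning
      sum-m⁺ : sum m⁺ ≡ suc (length Ts)
      sum-m⁺ = trans (∑-distrib-+ m (indicator b)) (trans (cong₂ _+_ sum-m (sum-indicator b)) (+-comm (length Ts) 1))
      mostA : AtMost (sum m) (comb m A)
      mostA = subst (λ k → AtMost k (comb m A)) (sym sum-m) (atMost-resp-↭ (↭-sym (↭-trans q p)) most)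
      bound : AtMost (suc (length Ts)) (A b ++ B)
      bound j sj = ≮⇒≥ λ k<j → ¬¬-optimal (zeroSum-++ {A b} {B} (proj₂ (proj₁ (fam b))) zB) λ where
        (j* , (Ts* , refl , blocks* , p*) , most*) →
          -- The competing partition is compressed as well, so that its column sums are also at most
          -- s n.
          let A′ , x′ , fam′ , q′ , sum-x′ , _ = compress (fromℕ< 1≤s) blocks* (atMost-resp-↭ (↭-sym p*) most*)
          in <⇒≱ k<j (≤-trans (most* j sj) (≤-trans (≤-reflexive (sym sum-x′)) (≤-trans
               (sum≤-of-≗ fam fam′ b m x′ many mostA λ g → trans (comb-m⁺ g)
                 (sym (trans (sym (count-comb x′ A′ g)) (count-resp-↭ (↭-trans q′ p*) g))))
               (≤-reflexive sum-m⁺))))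

  rounding-bound : ∀ s d₀ → 1 ≤ s → suc (s * n) ^ n < 2 ^ s → IsD₀ G e d₀ →
    DFormulaFrom G e d₀ (s * suc (s * n + s * n) ^ n + n * e)
  rounding-bound s d₀ 1≤s subsets = DFormula-from Q (n * e) d₀ η-n*e (m≤n*m e n {{>-nonZero 1≤n}})
    (pump-rounding s subsets 1≤s) (≤-trans (*-mono-≤ 1≤n 1≤e) (m≤n+m (n * e) Q))
    (λ k K≤k → ≤-trans K≤k (≤-trans (m≤m+n k (suc d₀)) (m≤m+n (k + suc d₀) e)))
    (λ k l K≤k D → ≤-trans (m≤n+m (n * e) Q) (≤-trans K≤k (≤-trans (k≤l k l D) (m≤m+n l e))))
    where
    Q = s * suc (s * n + s * n) ^ n
    -- Disjoint blocks need at least one term each; as n e ≤ K ≤ k, this makes `l` large enough for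
    -- η to apply.
    k≤l : ∀ k l → DProperty k l → k ≤ l
    k≤l k l D with D (replicate l ε) (≤-reflexive (sym (List.length-replicate l)))
    ... | Ts , refl , blocks , z , p = begin
      length Ts                          ≤⟨ length-concat blocks ⟩
      length (concat Ts)                 ≤⟨ m≤m+n (length (concat Ts)) (length z) ⟩
      length (concat Ts) + length z      ≡⟨ length-++-↭ (concat Ts) z p ⟩
      length (replicate l ε)             ≡⟨ List.length-replicate l ⟩
      l                                  ∎
      where open ≤-Reasoning

-- Numerical estimates.

n<2^n : ∀ n → n < 2 ^ n
n<2^n zero    = s≤s z≤n
n<2^n (suc n) = +-mono-≤ (m^n>0 2 n) (≤-trans (n<2^n n) (m≤m+n (2 ^ n) 0))

-- The n-th power of 4 n³ + 1 < (n + 1)⁴ ≤ 2^(4 n); this is what the choice s = 4 n² is made for.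
enough-subsets : ∀ n → 1 ≤ n → suc (4 * n * n * n) ^ n < 2 ^ (4 * n * n)
enough-subsets n@(suc k) 1≤n = begin-strict
  suc (4 * n * n * n) ^ n   <⟨ ^-monoˡ-< n (begin-strict
    suc (4 * n * n * n)       <⟨ m<m+n (suc (4 * n * n * n)) (s≤s z≤n) ⟩
    -- The second summand is (n + 1)⁴ - (4 n³ + 1), expanded in k = n - 1.
    suc (4 * n * n * n) + suc (k * k * k * k + 4 * k * k * k + 12 * k * k + 20 * k + 10) ≡⟨ expand k ⟩
    suc n ^ 4                 ≤⟨ ^-monoˡ-≤ 4 (n<2^n n) ⟩
    (2 ^ n) ^ 4               ≡⟨ ^-*-assoc 2 n 4 ⟩
    2 ^ (n * 4)               ≡⟨ cong (2 ^_) (*-comm n 4) ⟩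
    2 ^ (4 * n)               ∎) ⟩
  (2 ^ (4 * n)) ^ n         ≡⟨ ^-*-assoc 2 (4 * n) n ⟩
  2 ^ (4 * n * n)           ∎
  where
  open ≤-Reasoning
  expand : ∀ k → suc (4 * suc k * suc k * suc k) + suc (k * k * k * k + 4 * k * k * k + 12 * k * k + 20 * k + 10) ≡ (2 + k) * ((2 + k) * ((2 + k) * ((2 + k) * 1)))
  expand = solve-∀

-- Here s = (2 n)². The summand n e ≤ s turns s M into at most s (M + 1), and M + 1 ≤ (2 n)^(4 n)
-- follows from 2 s n + 2 ≤ (2 n)⁴.
final-bound : ∀ n e → 1 ≤ n → e ≤ n →
  4 * n * n * suc (4 * n * n * n + 4 * n * n * n) ^ n + n * e ≤ (2 * n) ^ (4 * n + 2)
final-bound n@(suc k) e 1≤n e≤n = begin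
  s * M + n * e                     ≤⟨ +-monoʳ-≤ (s * M) (≤-trans (*-monoʳ-≤ n e≤n) (*-monoˡ-≤ n (m≤n*m n 4))) ⟩
  s * M + s                         ≡⟨ +-comm (s * M) s ⟩
  s + s * M                         ≡⟨ *-suc s M ⟨
  s * suc M                         ≤⟨ *-monoʳ-≤ s (^-monoˡ-< n (begin
    2 + (s * n + s * n)               ≤⟨ m≤m+n _ _ ⟩
    2 + (s * n + s * n) + (16 * k * k * k * k + 56 * k * k * k + 72 * k * k + 40 * k + 6) ≡⟨ expand k ⟩
    (2 * n) ^ 4                       ∎)) ⟩
  s * ((2 * n) ^ 4) ^ n             ≡⟨ cong₂ _*_ (square n) (^-*-assoc (2 * n) 4 n) ⟩
  (2 * n) ^ 2 * (2 * n) ^ (4 * n)   ≡⟨ *-comm ((2 * n) ^ 2) _ ⟩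
  (2 * n) ^ (4 * n) * (2 * n) ^ 2   ≡⟨ ^-distribˡ-+-* (2 * n) (4 * n) 2 ⟨
  (2 * n) ^ (4 * n + 2)             ∎
  where
  open ≤-Reasoning
  s = 4 * n * n
  M = suc (s * n + s * n) ^ n
  expand : ∀ k → 2 + (4 * suc k * suc k * suc k + 4 * suc k * suc k * suc k) + (16 * k * k * k * k + 56 * k * k * k + 72 * k * k + 40 * k + 6)
    ≡ (2 * suc k) * ((2 * suc k) * ((2 * suc k) * ((2 * suc k) * 1)))
  expand = solve-∀
  square : ∀ n → 4 * n * n ≡ (2 * n) * ((2 * n) * 1)
  square = solve-∀

nontrivial⇒1<exponent : ∀ {c ℓ} (G : AbelianGroup c ℓ) {n e} → HasOrder G n → 1 < n → IsExponent G e → 1 < e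
nontrivial⇒1<exponent G order 1<n ((1≤e , annihilates) , _) = ≤∧≢⇒< 1≤e λ where
    refl → distinct order 1<n annihilates
  where
  open AbelianGroup G using (_≈_; ε; identityʳ; rawMonoid) renaming (setoid to G-setoid; sym to ≈-sym; trans to ≈-trans)
  distinct : ∀ {n} → HasOrder G n → 1 < n → ¬ (∀ x → multiple rawMonoid 1 x ≈ ε)
  distinct {suc zero}    _ (s≤s ())
  distinct {suc (suc n)} order _ trivial = Fin.0≢1+n (begin
    zero                       ≡⟨ index-element zero ⟨
    index (element zero)       ≡⟨ index-cong (≈-trans (≈ε (element zero)) (≈-sym (≈ε (element (suc zero))))) ⟩
    index (element (suc zero)) ≡⟨ index-element (suc zero) ⟩
    suc zero                   ∎)
    where
    open ≡-Reasoning
    open Counting G-setoid (suc (suc n)) order using (index; element; index-element; index-cong)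
    ≈ε : ∀ x → x ≈ ε
    ≈ε x = ≈-trans (≈-sym (identityʳ x)) (trivial x)


open import Data.Integer.Base as ℤ using (+_)

theorem6p6 : ∀ {c ℓ c′ ℓ′} (G : AbelianGroup c ℓ) (n e d₀ kD : ℕ) →
    HasOrder G n → IsExponent G e → IsD₀ G e d₀ → IskD G e d₀ kD →
    (1 < n → ∀ (G⁻ : AbelianGroup c′ ℓ′) (δ ∣𝒜∣ η d⁻ : ℕ) →
    IsDelta G δ → HasCardinality (𝒜 G) ∣𝒜∣ → IsEta G e η →
    IsMinusPart G e G⁻ → IsD G⁻ 1 d⁻ →
    + kD ℤ.≤ + (δ * e * ∣𝒜∣) ℤ.+ + η ℤ.- + d⁻)
    × kD ≤ (2 * n) ^ (4 * n + 2)
theorem6p6 G n e d₀ kD order exponent isD₀ (_ , kD-least) =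
  (λ 1<n G⁻ δ N η d⁻ isDelta card isEta isMinus isD →
    let 1<e = nontrivial⇒1<exponent G order 1<n exponent
        d⁻≤η , formula = Factorizations.δ-bound G n order e 1≤e G⁻ isMinus 1<e d⁻ isD δ N η d₀ isDelta card isEta isD₀
        d⁻≤ = ≤-trans d⁻≤η (m≤n+m η (δ * e * N))
    -- Because d⁻ ≤ η, the integer difference in the claim agrees with the truncated one.
    in subst (+ kD ℤ.≤_) (sym (trans (ℤ.m-n≡m⊖n (δ * e * N + η) d⁻) (ℤ.⊖-≥ d⁻≤)))
         (ℤ.+≤+ (kD-least _ formula)))
  , ≤-trans (kD-least _ (rounding-bound (4 * n * n) d₀ (*-mono-≤ (*-mono-≤ {1} {4} (s≤s z≤n) 1≤n) 1≤n) (enough-subsets n 1≤n) isD₀))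
      (final-bound n e 1≤n e≤n)
  where open Compression G n order e exponent
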